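{- For every pair of positive integers $d \geq 5$ and $n$, there is a $d$-dimensional simplicial polytope $Q$ and a bijection $\varphi: [d]^n \to V(Q)$ such that for any combinatorial line $L$ in $\mathrm{HJ}(d,n)$, the image $\varphi(L)$ is the vertex set of some facet of $Q$.
   Context: For positive integers $d,n$, and $\tau=(\tau_1,\dots,\tau_n)\in([d]\cup\{*\})^n\setminus[d]^n$ (so $*$ appears at least once), and $k\in\mathbb{R}$, let $\sigma(\tau,k)\in\mathbb{R}^n$ be the word obtained by replacing every occurrence of $*$ in $\tau$ by $k$. The combinatorial line $L_\tau$ is $\{\sigma(\tau,k): k\in[d]\}\subseteq[d]^n$. The Hales-Jewett hypergraph $\mathrm{HJ}(d,n)$ is the hypergraph on ground set $[d]^n$ whose hyperedges are all combinatorial lines $L_\tau$. $V(Q)$ denotes the vertex set of $Q$.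
   Formalization: The formal statement requires n ≥ 2 instead of n positive: for n = 1 the claim is false, since V(Q) would have only d elements while every d-dimensional polytope has at least d+1 vertices. -}

module Defs where

open import Algebra.Structures using (IsCommutativeRing)
open import Data.Fin.Base using (Fin)
open import Data.Maybe.Base using (Maybe; nothing; fromMaybe)
open import Data.Nat.Base using (ℕ; suc)
open import Data.Product.Base using (Σ; ∃; ∃-syntax; Σ-syntax; _×_; _,_; proj₁)
open import Data.Vec.Base using (Vec; map; zipWith; replicate; foldr′)
open import Data.Vec.Membership.Propositional using () renaming (_∈_ to _∈ᵛ_)
open import Data.Vec.Relation.Unary.All using (All)
open import Level using (0ℓ)
open import Relation.Binary.Bundles using (Setoid)
open import Relation.Binary.Core using (Rel)
open import Relation.Binary.PropositionalEquality using (_≡_; _≢_; setoid)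
open import Relation.Binary.Structures using (IsStrictTotalOrder)
open import Relation.Unary using (Pred; _∈_; _⊆_; _≐_; _∩_; ｛_｝; Satisfiable)
import Relation.Binary.Construct.On as On
import Relation.Binary.Construct.StrictToNonStrict as StrictToNonStrict

-- The standard library has no real numbers.  They enter through their
-- categorical axiomatisation: a Dedekind-complete ordered field.
record RealNumbers : Set₁ where
  infixl 6 _+_
  infixl 7 _*_
  infix  8 -_
  infix  4 _<_
  field
    ℝ                  : Set
    _+_ _*_            : ℝ → ℝ → ℝ
    -_                 : ℝ → ℝ
    0# 1#              : ℝ
    _<_                : Rel ℝ 0ℓ
    isCommutativeRing  : IsCommutativeRing _≡_ _+_ _*_ -_ 0# 1#
    0≢1                : 0# ≢ 1#
    inverse            : ∀ x → x ≢ 0# → ∃[ y ] x * y ≡ 1#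
    isStrictTotalOrder : IsStrictTotalOrder _≡_ _<_
    +-monoˡ-<          : ∀ {x y} z → x < y → x + z < y + z
    *-pos              : ∀ {x y} → 0# < x → 0# < y → 0# < x * y

  open StrictToNonStrict _≡_ _<_ public using (_≤_)

  UpperBound : Pred ℝ 0ℓ → Pred ℝ 0ℓ
  UpperBound S u = ∀ x → x ∈ S → x ≤ u

  field
    supremum : (S : Pred ℝ 0ℓ) → Satisfiable S → Satisfiable (UpperBound S) →
               ∃[ s ] s ∈ UpperBound S × (∀ u → u ∈ UpperBound S → s ≤ u)

module Polytopes (R : RealNumbers) where
  open RealNumbers R

  Point : ℕ → Set
  Point N = Vec ℝ N

  Subset : ℕ → Set₁
  Subset N = Pred (Point N) 0ℓ

  private variable
    N m : ℕ

  sum : Vec ℝ m → ℝ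
  sum = foldr′ _+_ 0#

  infix 7 _∙_
  _∙_ : Point N → Point N → ℝ
  x ∙ y = sum (zipWith _*_ x y)

  origin : Point N
  origin = replicate _ 0#

  -- combination w ps = Σᵢ wᵢ pᵢ
  combination : Vec ℝ m → Vec (Point N) m → Point N
  combination w ps = foldr′ (zipWith _+_) origin (zipWith (λ a → map (a *_)) w ps)

  conv : Vec (Point N) m → Subset N
  conv {m = m} ps x =
    Σ[ w ∈ Vec ℝ m ] All (0# ≤_) w × sum w ≡ 1# × combination w ps ≡ x

  aff : Vec (Point N) m → Subset N
  aff {m = m} ps x = Σ[ w ∈ Vec ℝ m ] sum w ≡ 1# × combination w ps ≡ x

  AffinelyIndependent : Vec (Point N) m → Set
  AffinelyIndependent {m = m} ps =
    (w : Vec ℝ m) → sum w ≡ 0# → combination w ps ≡ origin → w ≡ replicate m 0#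

  -- The affine hull of S has an affine basis of k + 1 points of S.  The empty
  -- set (of dimension -1) has no dimension in this sense.
  HasDimension : Subset N → ℕ → Set
  HasDimension {N} S k =
    Σ[ ps ∈ Vec (Point N) (suc k) ] All S ps × AffinelyIndependent ps × S ⊆ aff ps

  IsPolytope : Subset N → Set
  IsPolytope {N} Q = ∃[ m ] Σ[ ps ∈ Vec (Point N) m ] Q ≐ conv ps

  IsSimplex : Subset N → Set
  IsSimplex {N} S =
    ∃[ k ] Σ[ ps ∈ Vec (Point N) (suc k) ] AffinelyIndependent ps × S ≐ conv ps

  -- Faces are cut out by valid linear inequalities; ∅ and Q itself count.
  IsFace : Subset N → Subset N → Set
  IsFace {N} Q F =
    Σ[ c ∈ Point N ] Σ[ b ∈ ℝ ]
      (∀ x → x ∈ Q → c ∙ x ≤ b) × F ≐ (Q ∩ λ x → c ∙ x ≡ b)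

  IsFacet : Subset N → Subset N → Set
  IsFacet Q F = IsFace Q F × ∃[ k ] HasDimension Q (suc k) × HasDimension F k

  V : Subset N → Subset N
  V Q v = IsFace Q ｛ v ｝

  -- V Q as a type: vertices are compared as points, ignoring the proofs.
  Vertex : Subset N → Setoid 0ℓ 0ℓ
  Vertex {N} Q = On.setoid {B = Σ (Point N) (V Q)} (setoid (Point N)) proj₁

  IsSimplicial : Subset N → Set₁
  IsSimplicial {N} Q = (F : Subset N) → IsFacet Q F → IsSimplex F

-- [d]ⁿ, with Fin d playing the role of [d] = {1, …, d}.
Word : ℕ → ℕ → Set
Word d n = Vec (Fin d) n

-- ([d] ∪ {*})ⁿ ∖ [d]ⁿ, with nothing playing the role of *.
Template : ℕ → ℕ → Set
Template d n = Σ[ τ ∈ Vec (Maybe (Fin d)) n ] nothing ∈ᵛ τ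

σ : ∀ {d n} → Template d n → Fin d → Word d n
σ (τ , _) k = map (fromMaybe k) τ

Line : ∀ {d n} → Template d n → Pred (Word d n) 0ℓ
Line τ x = ∃[ k ] x ≡ σ τ k

record Hypergraph : Set₁ where
  field
    Ground    : Set
    Hyperedge : Pred (Pred Ground 0ℓ) 0ℓ

HJ : ℕ → ℕ → Hypergraph
HJ d n = record
  { Ground    = Word d n
  ; Hyperedge = λ L → Σ[ τ ∈ Template d n ] L ≐ Line τ
  }

image : {A B : Set} → (A → B) → Pred A 0ℓ → Pred B 0ℓ
image f S y = ∃[ x ] x ∈ S × f x ≡ y

{-# OPTIONS --safe #-}

-- Map a word x to the plane by u = Σ xᵢ and v = Σ sⁱ xᵢ + ε Σ xᵢ^(d-2), and
-- then to ℝᵈ by (v, uv, v², u, u², …, u^(d-3)).  For ε = 0 a combinatorial line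
-- lies on a line ℓ = 0 of the (u,v)-plane which, for generic s, contains no
-- other word; ℓ² is an affine functional of the image, nonnegative, and zero
-- exactly on the combinatorial line.  For small ε ≠ 0 the d points of a
-- combinatorial line become affinely independent, because v now contributes the
-- powers k^(d-2) and k^(d-1) of the parameter k that the powers of u lack, and
-- ℓ² can be corrected by O(ε) so as to vanish on them again.  Facets that are
-- simplices survive small perturbations, so the points can finally be moved
-- into general position, one at a time, which makes the polytope simplicial.
module Submission where

open import Defs
open import Algebra.Bundles using (CommutativeRing)
import Algebra.Properties.Ring
import Algebra.Properties.Semiring.Mult.TCOptimised
import Algebra.Solver.Ring
open import Algebra.Solver.Ring.AlmostCommutativeRing using (fromCommutativeRing; _-Raw-AlmostCommutative⟶_)
open import Data.Bool.Base using (Bool; true; false)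
open import Data.Bool.Properties using (¬-not)
open import Data.Fin.Base using (Fin; zero; suc; toℕ; fromℕ<; combine; remQuot)
import Data.Fin.Properties as Fin
open import Data.Integer.Base as ℤ using (ℤ; -[1+_]; _⊖_)
import Data.Integer.Properties as ℤ
open import Data.Maybe.Base using (Maybe; just; nothing; maybe′; fromMaybe)
import Data.Maybe.Properties as Maybe
open import Data.Nat.Base as ℕ using (ℕ; zero; suc)
import Data.Nat.Properties as ℕ
open import Data.Product.Base using (∃-syntax; Σ-syntax; _×_; _,_; proj₁; proj₂)
open import Data.Sum.Base using (_⊎_; inj₁; inj₂)
open import Data.Vec.Base using (Vec; []; _∷_; map; zipWith; replicate; lookup; tabulate; head; tail; _[_]≔_)
open import Data.Vec.Membership.Propositional using () renaming (_∈_ to _∈ᵛ_)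
open import Data.Vec.Properties using (tabulate∘lookup; tabulate-cong; lookup-replicate; lookup∘tabulate; lookup∘update; lookup∘update′; lookup-map; ≡-dec)
open import Data.Vec.Relation.Unary.All as All using (All; []; _∷_)
import Data.Vec.Relation.Unary.All.Properties as All
open import Data.Vec.Relation.Unary.Any as Any using (here; there)
open import Function.Base using (_∘_)
open import Function.Bundles using (Bijection)
open import Level using (0ℓ)
open import Relation.Binary.Definitions using (tri<; tri≈; tri>)
open import Relation.Binary.PropositionalEquality
open import Relation.Binary.Structures using (IsStrictTotalOrder)
open import Relation.Nullary using (¬_; Dec; yes; no; does; contradiction; ¬?)
open import Relation.Unary using (Pred; _⊆_; _≐_; _∩_; Satisfiable) renaming (_∈_ to _∈ₚ_)

-- The affine functionals on the image are spanned by the d + 1 functions 1, u, ..., u^(d-3), v, uv,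
-- v². For ε = 0 both u and v are affine in the letter k along a combinatorial line, so all of these
-- restrict to polynomials in k of degree at most d-3, and the d points of the line span an affine
-- space of dimension only d-3. For ε > 0 the restrictions exhaust all functions on the d letters.
-- Exactly one dimension of functionals is then left that vanishes on the line, and it has to supply
-- the supporting hyperplane. The bound d ≥ 5 puts u² among the coordinates; ℓ² needs it in order to
-- be an affine functional of the image. A facet is carried as a certificate made of values of
-- affine functionals (`SimplexFacet`). The numbers s and ε and the displacements are chosen one
-- after another as sufficiently small positive reals, so every genericity or stability claim
-- becomes a statement about a polynomial near 0, proved by algebra alone.

module Realisation (R : RealNumbers) where
  open RealNumbers R
  open Polytopes R
  open IsStrictTotalOrder isStrictTotalOrder using (compare; _≟_) renaming (trans to <-trans; irrefl to <-irrefl)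

  private variable
    d k m n N : ℕ
    X Y : Set
    P P′ : ℝ → Set

  -- Ring reasoning over ℝ with integer coefficients

  commutativeRing : CommutativeRing 0ℓ 0ℓ
  commutativeRing = record { isCommutativeRing = isCommutativeRing }

  open CommutativeRing commutativeRing
    using (+-assoc; +-comm; +-identityˡ; +-identityʳ; -‿inverseʳ; *-assoc; *-comm; *-identityˡ; *-identityʳ; zeroˡ; zeroʳ)

  module Field where
    open Algebra.Properties.Ring (CommutativeRing.ring commutativeRing) public
    open Algebra.Properties.Semiring.Mult.TCOptimised (CommutativeRing.semiring commutativeRing) public renaming (_×_ to _·_)
  open Field using (_·_)

  -- The ring solver needs coefficients on which equality computes, which ℝ itself does not provide.
  ℤ→ℝ : ℤ → ℝ
  ℤ→ℝ (ℤ.+ n)    = n · 1#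
  ℤ→ℝ -[1+ n ] = - (suc n · 1#)

  ℤ→ℝ-⊖ : ∀ m n → ℤ→ℝ (m ⊖ n) ≡ m · 1# + - (n · 1#)
  ℤ→ℝ-⊖ zero zero = sym (trans (cong (0# +_) Field.-0#≈0#) (+-identityˡ 0#))
  ℤ→ℝ-⊖ zero (suc n) = sym (+-identityˡ _)
  ℤ→ℝ-⊖ (suc m) zero = sym (trans (cong (suc m · 1# +_) Field.-0#≈0#) (+-identityʳ _))
  ℤ→ℝ-⊖ (suc m) (suc n) = begin
    ℤ→ℝ (suc m ⊖ suc n)              ≡⟨ cong ℤ→ℝ (ℤ.[1+m]⊖[1+n]≡m⊖n m n) ⟩
    ℤ→ℝ (m ⊖ n)                      ≡⟨ ℤ→ℝ-⊖ m n ⟩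
    x + - y                          ≡⟨ cong (_+ - y) (Field.xyx⁻¹≈y 1# x) ⟨
    1# + x + - 1# + - y              ≡⟨ +-assoc _ _ _ ⟩
    1# + x + (- 1# + - y)            ≡⟨ cong (1# + x +_) (Field.-‿+-comm 1# y) ⟩
    1# + x + - (1# + y)              ≡⟨ cong₂ (λ a b → a + - b) (Field.1+× m 1#) (Field.1+× n 1#) ⟨
    suc m · 1# + - (suc n · 1#)      ∎
    where
    open ≡-Reasoning
    x = m · 1#
    y = n · 1#

  ℤ→ℝ-neg : ∀ i → ℤ→ℝ (ℤ.- i) ≡ - ℤ→ℝ i
  ℤ→ℝ-neg (ℤ.+ zero)  = sym Field.-0#≈0#
  ℤ→ℝ-neg (ℤ.+ suc n) = refl
  ℤ→ℝ-neg -[1+ n ]  = sym (Field.-‿involutive _)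

  ℤ→ℝ-+ : ∀ i j → ℤ→ℝ (i ℤ.+ j) ≡ ℤ→ℝ i + ℤ→ℝ j
  ℤ→ℝ-+ (ℤ.+ m) (ℤ.+ n) = Field.×-homo-+ 1# m n
  ℤ→ℝ-+ (ℤ.+ m) -[1+ n ] = ℤ→ℝ-⊖ m (suc n)
  ℤ→ℝ-+ -[1+ m ] (ℤ.+ n) = trans (ℤ→ℝ-⊖ n (suc m)) (+-comm _ _)
  ℤ→ℝ-+ -[1+ m ] -[1+ n ] = begin
    ℤ→ℝ (-[1+ m ] ℤ.+ -[1+ n ])        ≡⟨ cong ℤ→ℝ (ℤ.neg-distrib-+ (ℤ.+ suc m) (ℤ.+ suc n)) ⟨
    - ((suc m ℕ.+ suc n) · 1#)          ≡⟨ cong -_ (Field.×-homo-+ 1# (suc m) (suc n)) ⟩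
    - (suc m · 1# + suc n · 1#)         ≡⟨ Field.-‿+-comm _ _ ⟨
    - (suc m · 1#) + - (suc n · 1#)     ∎
    where open ≡-Reasoning

  ℤ→ℝ-* : ∀ i j → ℤ→ℝ (i ℤ.* j) ≡ ℤ→ℝ i * ℤ→ℝ j
  ℤ→ℝ-*-pos : ∀ i n → ℤ→ℝ (i ℤ.* ℤ.+ n) ≡ ℤ→ℝ i * ℤ→ℝ (ℤ.+ n)
  ℤ→ℝ-*-pos (ℤ.+ m) n = trans (cong ℤ→ℝ (sym (ℤ.pos-* m n))) (Field.×1-homo-* m n)
  ℤ→ℝ-*-pos -[1+ m ] n = begin
    ℤ→ℝ (ℤ.- (ℤ.+ suc m) ℤ.* ℤ.+ n)        ≡⟨ cong ℤ→ℝ (ℤ.neg-distribˡ-* (ℤ.+ suc m) (ℤ.+ n)) ⟨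
    ℤ→ℝ (ℤ.- (ℤ.+ suc m ℤ.* ℤ.+ n))        ≡⟨ ℤ→ℝ-neg (ℤ.+ suc m ℤ.* ℤ.+ n) ⟩
    - ℤ→ℝ (ℤ.+ suc m ℤ.* ℤ.+ n)            ≡⟨ cong -_ (ℤ→ℝ-*-pos (ℤ.+ suc m) n) ⟩
    - (ℤ→ℝ (ℤ.+ suc m) * ℤ→ℝ (ℤ.+ n))     ≡⟨ Field.-‿distribˡ-* _ _ ⟩
    - ℤ→ℝ (ℤ.+ suc m) * ℤ→ℝ (ℤ.+ n)       ∎
    where open ≡-Reasoning
  ℤ→ℝ-* i (ℤ.+ n) = ℤ→ℝ-*-pos i n
  ℤ→ℝ-* i -[1+ n ] = begin
    ℤ→ℝ (i ℤ.* ℤ.- (ℤ.+ suc n))          ≡⟨ cong ℤ→ℝ (ℤ.neg-distribʳ-* i (ℤ.+ suc n)) ⟨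
    ℤ→ℝ (ℤ.- (i ℤ.* ℤ.+ suc n))          ≡⟨ ℤ→ℝ-neg (i ℤ.* ℤ.+ suc n) ⟩
    - ℤ→ℝ (i ℤ.* ℤ.+ suc n)              ≡⟨ cong -_ (ℤ→ℝ-*-pos i (suc n)) ⟩
    - (ℤ→ℝ i * ℤ→ℝ (ℤ.+ suc n))         ≡⟨ Field.-‿distribʳ-* _ _ ⟩
    ℤ→ℝ i * - ℤ→ℝ (ℤ.+ suc n)           ∎
    where open ≡-Reasoning

  ℤ→ℝ-morphism : ℤ.+-*-rawRing -Raw-AlmostCommutative⟶ fromCommutativeRing commutativeRing
  ℤ→ℝ-morphism = record
    { ⟦_⟧    = ℤ→ℝ
    ; +-homo = ℤ→ℝ-+
    ; *-homo = ℤ→ℝ-*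
    ; -‿homo = ℤ→ℝ-neg
    ; 0-homo = refl
    ; 1-homo = refl
    }

  ℤ-equal : (i j : ℤ) → Maybe (ℤ→ℝ i ≡ ℤ→ℝ j)
  ℤ-equal i j with i ℤ.≟ j
  ... | yes i≡j = just (cong ℤ→ℝ i≡j)
  ... | no  _   = nothing

  open Algebra.Solver.Ring ℤ.+-*-rawRing (fromCommutativeRing commutativeRing) ℤ→ℝ-morphism ℤ-equal
    using (solve; _:=_; _:+_; _:*_; :-_; _:-_; con)

  -- Ordered field arithmetic

  infixl 6 _−_
  _−_ : ℝ → ℝ → ℝ
  x − y = x + - y

  _·1 : ℕ → ℝ
  n ·1 = n · 1#

  0<1 : 0# < 1#
  0<1 with compare 0# 1#
  ... | tri< 0<1 _ _ = 0<1
  ... | tri≈ _ 0≡1 _ = contradiction 0≡1 0≢1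
  -- Here `- 1#` is positive, hence so is its square `1#`.
  ... | tri> _ _ 1<0 = contradiction (<-trans 1<0 (subst (0# <_) (solve 1 (λ x → (:- con (ℤ.+ 1)) :* (:- con (ℤ.+ 1)) := con (ℤ.+ 1)) refl 0#) (*-pos 0<-1 0<-1))) (<-irrefl refl)
    where
    0<-1 : 0# < - 1#
    0<-1 = subst₂ _<_ (-‿inverseʳ 1#) (+-identityˡ _) (+-monoˡ-< (- 1#) 1<0)

  x<y⇒0<y−x : ∀ {x y} → x < y → 0# < y − x
  x<y⇒0<y−x {x} {y} x<y = subst (_< y − x) (-‿inverseʳ x) (+-monoˡ-< (- x) x<y)

  0<y−x⇒x<y : ∀ {x y} → 0# < y − x → x < y
  0<y−x⇒x<y {x} {y} 0<y−x = subst₂ _<_ (+-identityˡ x) (solve 2 (λ x y → y :- x :+ x := y) refl x y) (+-monoˡ-< x 0<y−x)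

  +-pos : ∀ {x y} → 0# < x → 0# < y → 0# < x + y
  +-pos {x} {y} 0<x 0<y = <-trans 0<y (subst (_< x + y) (+-identityˡ y) (+-monoˡ-< y 0<x))

  0≤-+-0< : ∀ {x y} → 0# ≤ x → 0# < y → 0# < x + y
  0≤-+-0< (inj₁ 0<x) 0<y = +-pos 0<x 0<y
  0≤-+-0< {y = y} (inj₂ refl) 0<y = subst (0# <_) (sym (+-identityˡ y)) 0<y

  +-nonneg : ∀ {x y} → 0# ≤ x → 0# ≤ y → 0# ≤ x + y
  +-nonneg 0≤x (inj₁ 0<y) = inj₁ (0≤-+-0< 0≤x 0<y)
  +-nonneg {x} 0≤x (inj₂ refl) = subst (0# ≤_) (sym (+-identityʳ x)) 0≤x

  *-nonneg : ∀ {x y} → 0# ≤ x → 0# ≤ y → 0# ≤ x * y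
  *-nonneg (inj₁ 0<x) (inj₁ 0<y) = inj₁ (*-pos 0<x 0<y)
  *-nonneg {y = y} (inj₂ refl) _ = inj₂ (sym (zeroˡ y))
  *-nonneg {x} (inj₁ _) (inj₂ refl) = inj₂ (sym (zeroʳ x))

  x≤y⇒0≤y−x : ∀ {x y} → x ≤ y → 0# ≤ y − x
  x≤y⇒0≤y−x (inj₁ x<y)  = inj₁ (x<y⇒0<y−x x<y)
  x≤y⇒0≤y−x {x} (inj₂ refl) = inj₂ (sym (-‿inverseʳ x))

  0≤y−x⇒x≤y : ∀ {x y} → 0# ≤ y − x → x ≤ y
  0≤y−x⇒x≤y (inj₁ p) = inj₁ (0<y−x⇒x<y p)
  0≤y−x⇒x≤y {x} {y} (inj₂ p) = inj₂ (sym (Field.x∙y⁻¹≈ε⇒x≈y y x (sym p)))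

  x<0⇒0<-x : ∀ {x} → x < 0# → 0# < - x
  x<0⇒0<-x {x} x<0 = subst (0# <_) (+-identityˡ _) (x<y⇒0<y−x x<0)

  0<⇒≢0 : ∀ {x} → 0# < x → x ≢ 0#
  0<⇒≢0 0<x refl = <-irrefl refl 0<x

  x≢0⇒0<x² : ∀ {x} → x ≢ 0# → 0# < x * x
  x≢0⇒0<x² {x} x≢0 with compare 0# x
  ... | tri< 0<x _ _ = *-pos 0<x 0<x
  ... | tri≈ _ 0≡x _ = contradiction (sym 0≡x) x≢0
  ... | tri> _ _ x<0 = subst (0# <_) (solve 1 (λ x → (:- x) :* (:- x) := x :* x) refl x) (*-pos (x<0⇒0<-x x<0) (x<0⇒0<-x x<0))

  *-cancel-0 : ∀ {x y} → x * y ≡ 0# → y ≢ 0# → x ≡ 0#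
  *-cancel-0 {x} {y} xy≡0 y≢0 = let z , yz≡1 = inverse y y≢0 in begin
    x             ≡⟨ *-identityʳ x ⟨
    x * 1#        ≡⟨ cong (x *_) yz≡1 ⟨
    x * (y * z)   ≡⟨ *-assoc x y z ⟨
    x * y * z     ≡⟨ cong (_* z) xy≡0 ⟩
    0# * z        ≡⟨ zeroˡ z ⟩
    0#            ∎
    where open ≡-Reasoning

  inverse-pos : ∀ {x y} → 0# < x → x * y ≡ 1# → 0# < y
  inverse-pos {x} {y} 0<x xy≡1 = subst (0# <_) eq (*-pos 0<x (x≢0⇒0<x² y≢0))
    where
    y≢0 : y ≢ 0#
    y≢0 refl = 0≢1 (trans (sym (zeroʳ x)) xy≡1)
    eq : x * (y * y) ≡ y
    eq = trans (sym (*-assoc x y y)) (trans (cong (_* y) xy≡1) (*-identityˡ y))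

  fraction : ∀ {c k} → 0# < c → 0# < k → Σ[ δ ∈ ℝ ] 0# < δ × δ * k ≡ c
  fraction {c} {k} 0<c 0<k =
    let h , kh≡1 = inverse k (0<⇒≢0 0<k) in
    c * h , *-pos 0<c (inverse-pos 0<k kh≡1) ,
    trans (*-assoc c h k) (trans (cong (c *_) (trans (*-comm h k) kh≡1)) (*-identityʳ c))

  ·1-nonneg : ∀ n → 0# ≤ n ·1
  ·1-nonneg zero = inj₂ refl
  ·1-nonneg (suc n) = subst (0# ≤_) (sym (Field.1+× n 1#)) (+-nonneg (inj₁ 0<1) (·1-nonneg n))

  ·1-pos : ∀ n → 0# < suc n ·1
  ·1-pos n = subst (0# <_) (trans (+-comm _ _) (sym (Field.1+× n 1#))) (0≤-+-0< (·1-nonneg n) 0<1)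

  ·1-injective : ∀ {m n} → m ·1 ≡ n ·1 → m ≡ n
  ·1-injective {zero} {zero} eq = refl
  ·1-injective {zero} {suc n} eq = contradiction (sym eq) (0<⇒≢0 (·1-pos n))
  ·1-injective {suc m} {zero} eq = contradiction eq (0<⇒≢0 (·1-pos m))
  ·1-injective {suc m} {suc n} eq = cong suc (·1-injective (Field.+-cancelˡ 1# (m ·1) (n ·1)
    (trans (sym (Field.1+× m 1#)) (trans eq (Field.1+× n 1#)))))

  -- Vectors, dot products and combinations

  infixl 6 _⊕_
  infixr 7 _⊛_

  _⊕_ : Point N → Point N → Point N
  _⊕_ = zipWith _+_

  _⊛_ : ℝ → Point N → Point N
  a ⊛ x = map (a *_) x

  0-⊛ : (x : Point N) → 0# ⊛ x ≡ origin
  0-⊛ [] = refl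
  0-⊛ (a ∷ x) = cong₂ _∷_ (zeroˡ a) (0-⊛ x)

  ∙-comm : (x y : Point N) → x ∙ y ≡ y ∙ x
  ∙-comm [] [] = refl
  ∙-comm (a ∷ x) (b ∷ y) = cong₂ _+_ (*-comm a b) (∙-comm x y)

  ∙-⊕ : (x y z : Point N) → x ∙ (y ⊕ z) ≡ x ∙ y + x ∙ z
  ∙-⊕ [] [] [] = sym (+-identityˡ 0#)
  ∙-⊕ (a ∷ x) (b ∷ y) (c ∷ z) = trans (cong (a * (b + c) +_) (∙-⊕ x y z))
    (solve 5 (λ a b c s t → a :* (b :+ c) :+ (s :+ t) := a :* b :+ s :+ (a :* c :+ t)) refl a b c (x ∙ y) (x ∙ z))

  ∙-⊛ : ∀ a (x y : Point N) → x ∙ (a ⊛ y) ≡ a * (x ∙ y)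
  ∙-⊛ a [] [] = sym (zeroʳ a)
  ∙-⊛ a (b ∷ x) (c ∷ y) = trans (cong (b * (a * c) +_) (∙-⊛ a x y))
    (solve 4 (λ a b c s → b :* (a :* c) :+ a :* s := a :* (b :* c :+ s)) refl a b c (x ∙ y))

  ∙-origin : (x : Point N) → x ∙ origin ≡ 0#
  ∙-origin [] = refl
  ∙-origin (a ∷ x) = trans (cong₂ _+_ (zeroʳ a) (∙-origin x)) (+-identityˡ 0#)

  origin-∙ : (x : Point N) → origin ∙ x ≡ 0#
  origin-∙ x = trans (∙-comm origin x) (∙-origin x)

  ⊕-∙ : (x y z : Point N) → (x ⊕ y) ∙ z ≡ x ∙ z + y ∙ z
  ⊕-∙ x y z = trans (∙-comm (x ⊕ y) z) (trans (∙-⊕ z x y) (cong₂ _+_ (∙-comm z x) (∙-comm z y)))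

  ⊛-∙ : ∀ a (x y : Point N) → (a ⊛ x) ∙ y ≡ a * (x ∙ y)
  ⊛-∙ a x y = trans (∙-comm (a ⊛ x) y) (trans (∙-⊛ a y x) (cong (a *_) (∙-comm y x)))

  ∙-combination : ∀ c (w : Vec ℝ m) (ps : Vec (Point N) m) → c ∙ combination w ps ≡ w ∙ map (c ∙_) ps
  ∙-combination c [] [] = ∙-origin c
  ∙-combination c (a ∷ w) (p ∷ ps) =
    trans (∙-⊕ c (a ⊛ p) (combination w ps)) (cong₂ _+_ (∙-⊛ a c p) (∙-combination c w ps))

  lookup-combination : ∀ (w : Vec ℝ m) (ps : Vec (Point N) m) i →
    lookup (combination w ps) i ≡ map (λ p → lookup p i) ps ∙ w
  lookup-combination [] [] i = lookup-replicate i 0#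
  lookup-combination (a ∷ w) (p ∷ ps) i =
    trans (lookup-⊕ (a ⊛ p) (combination w ps) i)
      (cong₂ _+_ (trans (lookup-⊛ a p i) (*-comm a _)) (lookup-combination w ps i))
    where
    lookup-⊕ : ∀ (x y : Point k) i → lookup (x ⊕ y) i ≡ lookup x i + lookup y i
    lookup-⊕ (_ ∷ _) (_ ∷ _) zero = refl
    lookup-⊕ (_ ∷ x) (_ ∷ y) (suc i) = lookup-⊕ x y i
    lookup-⊛ : ∀ a (x : Point k) i → lookup (a ⊛ x) i ≡ a * lookup x i
    lookup-⊛ a (_ ∷ _) zero = refl
    lookup-⊛ a (_ ∷ x) (suc i) = lookup-⊛ a x i

  lookup-ext : {x y : Vec X k} → (∀ i → lookup x i ≡ lookup y i) → x ≡ y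
  lookup-ext {x = x} {y} eq = trans (sym (tabulate∘lookup x)) (trans (tabulate-cong eq) (tabulate∘lookup y))

  -- Linear systems

  -- Elimination uses only these three facts: the adjoint identity transports the remaining
  -- equations through `g`, and the last clause keeps solutions nonzero.
  Kernel : Vec ℝ (suc k) → Set
  Kernel {k} e =
    Σ[ g ∈ (Vec ℝ k → Vec ℝ (suc k)) ] Σ[ gᵀ ∈ (Vec ℝ (suc k) → Vec ℝ k) ]
      (∀ b y → b ∙ g y ≡ gᵀ b ∙ y) × (∀ y → e ∙ g y ≡ 0#) × (∀ y → g y ≡ origin → y ≡ origin)

  -- Eliminating one variable: g parametrises the hyperplane e ∙ x = 0, and gᵀ pulls the other equations back along g.
  hyperplane-parametrisation : (e : Vec ℝ (suc k)) → Kernel e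
  hyperplane-parametrisation {k} (a ∷ e) with a ≟ 0#
  -- The solutions of the zero equation form a whole line, more than the image of `g`. `Kernel` asks
  -- for injectivity, not for all solutions.
  hyperplane-parametrisation {zero} (a ∷ []) | yes refl =
    (λ _ → 0# ∷ []) , (λ _ → []) ,
    (λ { (b ∷ []) [] → trans (+-identityʳ _) (zeroʳ b) }) , (λ _ → trans (+-identityʳ _) (zeroʳ 0#)) , (λ { [] _ → refl })
  hyperplane-parametrisation {suc k} (a ∷ e) | yes refl =
    let g , gᵀ , adjoint , kernel , injective = hyperplane-parametrisation e in
    (λ { (y ∷ ys) → y ∷ g ys }) , (λ { (b ∷ bs) → b ∷ gᵀ bs }) ,
    (λ { (b ∷ bs) (y ∷ ys) → cong (b * y +_) (adjoint bs ys) }) ,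
    (λ { (y ∷ ys) → trans (cong₂ _+_ (zeroˡ y) (kernel ys)) (+-identityˡ 0#) }) ,
    (λ { (y ∷ ys) eq → cong₂ _∷_ (cong head eq) (injective ys (cong tail eq)) })
  ... | no a≢0 = let h , ah≡1 = inverse a a≢0 in
    (λ y → - (h * (e ∙ y)) ∷ y) , (λ { (b ∷ bs) → bs ⊕ (- (b * h)) ⊛ e }) ,
    (λ { (b ∷ bs) y → trans
        (solve 4 (λ b h s t → b :* (:- (h :* s)) :+ t := t :+ (:- (b :* h)) :* s) refl b h (e ∙ y) (bs ∙ y))
        (sym (trans (⊕-∙ bs ((- (b * h)) ⊛ e) y) (cong (bs ∙ y +_) (⊛-∙ (- (b * h)) e y)))) }) ,
    (λ y → trans (solve 3 (λ a h s → a :* (:- (h :* s)) :+ s := (con (ℤ.+ 1) :- a :* h) :* s) refl a h (e ∙ y))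
        (trans (cong (λ z → (1# − z) * (e ∙ y)) ah≡1) (trans (cong (_* (e ∙ y)) (-‿inverseʳ 1#)) (zeroˡ _)))) ,
    (λ y eq → cong tail eq)

  linear-system : ∀ {r s} → r ℕ.< s → (es : Fin r → Vec ℝ s) → Σ[ x ∈ Vec ℝ s ] x ≢ origin × (∀ i → es i ∙ x ≡ 0#)
  linear-system {zero} {suc s} _ es = 1# ∷ origin , (λ eq → 0≢1 (sym (cong head eq))) , (λ ())
  linear-system {suc r} {suc s} (ℕ.s≤s r<s) es =
    let g , gᵀ , adjoint , kernel , injective = hyperplane-parametrisation (es zero)
        x , x≢0 , solves = linear-system r<s (λ i → gᵀ (es (suc i)))
    in g x , (λ eq → x≢0 (injective x eq)) ,
       (λ { zero → kernel x ; (suc i) → trans (adjoint (es (suc i)) x) (solves i) })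

  linear-dependence : ∀ {r s} → r ℕ.< s → (qs : Vec (Point r) s) → Σ[ w ∈ Vec ℝ s ] w ≢ origin × combination w qs ≡ origin
  linear-dependence r<s qs =
    let w , w≢0 , solves = linear-system r<s (λ i → map (λ q → lookup q i) qs) in
    w , w≢0 , lookup-ext (λ i → trans (lookup-combination w qs i) (trans (solves i) (sym (lookup-replicate i 0#))))

  -- Polynomials

  powers : ∀ k → ℝ → Vec ℝ k
  powers zero    t = []
  powers (suc k) t = 1# ∷ t ⊛ powers k t

  -- As evaluation is a dot product, a linear functional along the moment curve `powers` is
  -- literally a polynomial in the parameter.
  eval : Vec ℝ k → ℝ → ℝ
  eval cs t = cs ∙ powers _ t

  eval-∷ : ∀ c (cs : Vec ℝ k) t → eval (c ∷ cs) t ≡ c + t * eval cs t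
  eval-∷ c cs t = cong₂ _+_ (*-identityʳ c) (∙-⊛ t cs (powers _ t))

  infixr 8 _^_
  _^_ : ℝ → ℕ → ℝ
  t ^ zero  = 1#
  t ^ suc k = t * t ^ k

  mul-linear : ∀ a b (cs : Vec ℝ k) → Σ[ ds ∈ Vec ℝ (suc k) ] (∀ t → eval ds t ≡ (a + b * t) * eval cs t)
  mul-linear a b [] = 0# ∷ [] , λ t → trans (+-identityʳ _) (trans (zeroˡ 1#) (sym (zeroʳ _)))
  mul-linear a b (c ∷ cs) with mul-linear a b cs
  ... | d ∷ ds , eq = a * c ∷ b * c + d ∷ ds , λ t → begin
    eval (a * c ∷ b * c + d ∷ ds) t          ≡⟨ eval-∷ (a * c) (b * c + d ∷ ds) t ⟩
    a * c + t * eval (b * c + d ∷ ds) t      ≡⟨ cong (λ z → a * c + t * z) (eval-∷ (b * c + d) ds t) ⟩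
    a * c + t * (b * c + d + t * eval ds t)  ≡⟨ solve 6 (λ a b c d t e → a :* c :+ t :* (b :* c :+ d :+ t :* e) := a :* c :+ t :* (b :* c :+ (d :+ t :* e))) refl a b c d t (eval ds t) ⟩
    a * c + t * (b * c + (d + t * eval ds t)) ≡⟨ cong (λ z → a * c + t * (b * c + z)) (trans (sym (eval-∷ d ds t)) (eq t)) ⟩
    a * c + t * (b * c + (a + b * t) * eval cs t) ≡⟨ solve 5 (λ a b c t e → a :* c :+ t :* (b :* c :+ (a :+ b :* t) :* e) := (a :+ b :* t) :* (c :+ t :* e)) refl a b c t (eval cs t) ⟩
    (a + b * t) * (c + t * eval cs t)        ≡⟨ cong ((a + b * t) *_) (eval-∷ c cs t) ⟨
    (a + b * t) * eval (c ∷ cs) t            ∎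
    where open ≡-Reasoning

  add-constant : ∀ a (cs : Vec ℝ (suc k)) → Σ[ ds ∈ Vec ℝ (suc k) ] (∀ t → eval ds t ≡ a + eval cs t)
  add-constant a (c ∷ cs) = a + c ∷ cs , λ t → begin
    eval (a + c ∷ cs) t     ≡⟨ eval-∷ (a + c) cs t ⟩
    a + c + t * eval cs t   ≡⟨ +-assoc a c _ ⟩
    a + (c + t * eval cs t) ≡⟨ cong (a +_) (eval-∷ c cs t) ⟨
    a + eval (c ∷ cs) t     ∎
    where open ≡-Reasoning

  substitute-linear : ∀ a b (cs : Vec ℝ k) → Σ[ ds ∈ Vec ℝ k ] (∀ t → eval ds t ≡ eval cs (a + b * t))
  substitute-linear a b [] = [] , λ _ → refl
  substitute-linear a b (c ∷ cs) =
    let ds , eq₁ = substitute-linear a b cs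
        es , eq₂ = mul-linear a b ds
        fs , eq₃ = add-constant c es
    in fs , λ t → trans (eq₃ t) (trans (cong (c +_) (trans (eq₂ t) (cong ((a + b * t) *_) (eq₁ t)))) (sym (eval-∷ c cs (a + b * t))))

  -- Newton's scheme: interpolate the divided differences against the first node at the other nodes,
  -- multiply by `t − r zero` and add `y zero`.
  interpolate : (r : Fin k → ℝ) → (∀ {i j} → r i ≡ r j → i ≡ j) → (y : Fin k → ℝ) →
                Σ[ cs ∈ Vec ℝ k ] (∀ i → eval cs (r i) ≡ y i)
  interpolate {zero} r r-inj y = [] , λ ()
  interpolate {suc k} r r-inj y = fs , values
    where
    gap≢0 : ∀ i → r (suc i) − r zero ≢ 0#
    gap≢0 i eq with r-inj {suc i} {zero} (Field.x∙y⁻¹≈ε⇒x≈y _ _ eq)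
    ... | ()
    gap⁻¹ : Fin k → ℝ
    gap⁻¹ i = proj₁ (inverse _ (gap≢0 i))
    rest = interpolate (λ i → r (suc i)) (λ eq → Fin.suc-injective (r-inj eq)) (λ i → (y (suc i) − y zero) * gap⁻¹ i)
    cs = proj₁ rest
    product = mul-linear (- r zero) 1# cs
    shifted = add-constant (y zero) (proj₁ product)
    fs = proj₁ shifted
    newton : ∀ t → eval fs t ≡ y zero + (- r zero + 1# * t) * eval cs t
    newton t = trans (proj₂ shifted t) (cong (y zero +_) (proj₂ product t))
    values : ∀ i → eval fs (r i) ≡ y i
    values zero = trans (newton (r zero))
      (solve 3 (λ y r e → y :+ (:- r :+ con (ℤ.+ 1) :* r) :* e := y) refl (y zero) (r zero) (eval cs (r zero)))
    values (suc i) = begin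
      eval fs x                                          ≡⟨ newton x ⟩
      y₀ + (- r₀ + 1# * x) * eval cs x                   ≡⟨ cong (λ z → y₀ + (- r₀ + 1# * x) * z) (proj₂ rest i) ⟩
      y₀ + (- r₀ + 1# * x) * ((yᵢ − y₀) * gap⁻¹ i)       ≡⟨ solve 5 (λ a b r x g → a :+ (:- r :+ con (ℤ.+ 1) :* x) :* ((b :- a) :* g) := a :+ ((x :- r) :* g) :* (b :- a)) refl y₀ yᵢ r₀ x (gap⁻¹ i) ⟩
      y₀ + ((x − r₀) * gap⁻¹ i) * (yᵢ − y₀)              ≡⟨ cong (λ z → y₀ + z * (yᵢ − y₀)) (proj₂ (inverse _ (gap≢0 i))) ⟩
      y₀ + 1# * (yᵢ − y₀)                                ≡⟨ solve 2 (λ a b → a :+ con (ℤ.+ 1) :* (b :- a) := b) refl y₀ yᵢ ⟩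
      yᵢ                                                 ∎
      where
      open ≡-Reasoning
      x = r (suc i)
      r₀ = r zero
      y₀ = y zero
      yᵢ = y (suc i)

  -- Properties of all sufficiently small positive numbers

  Small : (ℝ → Set) → Set
  Small P = Σ[ δ ∈ ℝ ] 0# < δ × (∀ t → 0# < t → t < δ → P t)

  small-const : (∀ t → 0# < t → P t) → Small P
  small-const p = 1# , 0<1 , λ t 0<t _ → p t 0<t

  small-map : (∀ t → 0# < t → P t → P′ t) → Small P → Small P′
  small-map f (δ , 0<δ , p) = δ , 0<δ , λ t 0<t t<δ → f t 0<t (p t 0<t t<δ)

  small-× : Small P → Small P′ → Small (λ t → P t × P′ t)
  small-× (δ , 0<δ , p) (η , 0<η , q) with compare δ η
  ... | tri< δ<η _ _  = δ , 0<δ , λ t 0<t t<δ → p t 0<t t<δ , q t 0<t (<-trans t<δ δ<η)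
  ... | tri≈ _ refl _ = δ , 0<δ , λ t 0<t t<δ → p t 0<t t<δ , q t 0<t t<δ
  ... | tri> _ _ η<δ  = η , 0<η , λ t 0<t t<η → p t 0<t (<-trans t<η η<δ) , q t 0<t t<η

  small-witness : Small P → Σ[ t ∈ ℝ ] 0# < t × P t
  small-witness (δ , 0<δ , p) =
    let h , 0<h , eq = fraction 0<δ (+-pos 0<1 0<1)
        h<δ = 0<y−x⇒x<y (subst (0# <_) (trans (solve 1 (λ h → h := h :* (con (ℤ.+ 1) :+ con (ℤ.+ 1)) :- h) refl h) (cong (_− h) eq)) 0<h)
    in h , 0<h , p h 0<h h<δ

  -- A choice-free notion of finiteness: a common bound exists for the whole family.
  Uniform : Set → Set₁
  Uniform X = {P : X → ℝ → Set} → (∀ a → Small (P a)) → Small (λ t → ∀ a → P a t)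

  uniform-Fin : Uniform (Fin k)
  uniform-Fin {zero} p = small-const λ _ _ ()
  uniform-Fin {suc k} p = small-map (λ { t _ (p₀ , p₊) zero → p₀ ; t _ (p₀ , p₊) (suc i) → p₊ i })
    (small-× (p zero) (uniform-Fin (λ i → p (suc i))))

  uniform-Bool : Uniform Bool
  uniform-Bool p = small-map (λ { t _ (pt , pf) true → pt ; t _ (pt , pf) false → pf }) (small-× (p true) (p false))

  uniform-Maybe : Uniform X → Uniform (Maybe X)
  uniform-Maybe u p = small-map (λ { t _ (pn , pj) nothing → pn ; t _ (pn , pj) (just a) → pj a })
    (small-× (p nothing) (u (λ a → p (just a))))

  uniform-Vec : Uniform X → Uniform (Vec X k)
  uniform-Vec {k = zero} u p = small-map (λ { t _ q [] → q }) (p [])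
  uniform-Vec {k = suc k} u p = small-map (λ { t _ q (a ∷ as) → q a as }) (u (λ a → uniform-Vec u (λ as → p (a ∷ as))))

  -- The hypothesis `X` does not involve `t`, so it can be decided before the threshold is chosen.
  small-→ : {X : Set} → Dec X → (X → Small P) → Small (λ t → X → P t)
  small-→ (yes a) p = small-map (λ t _ q _ → q) (p a)
  small-→ (no ¬a) p = small-const (λ t _ a → contradiction a ¬a)

  small-linear : ∀ {c} a → 0# < c → Small (λ t → 0# < c − t * a)
  small-linear {c} a 0<c with compare 0# a
  ... | tri< 0<a _ _ = let δ , 0<δ , δa≡c = fraction 0<c 0<a in
    δ , 0<δ , λ t 0<t t<δ → subst (0# <_)
      (trans (solve 3 (λ δ t a → (δ :- t) :* a := δ :* a :- t :* a) refl δ t a) (cong (_− t * a) δa≡c))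
      (*-pos (x<y⇒0<y−x t<δ) 0<a)
  ... | tri≈ _ refl _ = small-const λ t _ → subst (0# <_) (solve 2 (λ c t → c := c :- t :* con (ℤ.+ 0)) refl c t) 0<c
  ... | tri> _ _ a<0 = small-const λ t 0<t → subst (0# <_) (solve 3 (λ c t a → c :+ t :* (:- a) := c :- t :* a) refl c t a) (+-pos 0<c (*-pos 0<t (x<0⇒0<-x a<0)))

  -- In place of continuity, `c + t (b + t e)` is split as `(c − t (1 − b)) + t (1 + t e)`: the
  -- first summand falls under `small-linear`, the second under the induction hypothesis with
  -- constant term `1#`.
  small-polynomial-pos : ∀ {c} → 0# < c → (cs : Vec ℝ k) → Small (λ t → 0# < c + t * eval cs t)
  small-polynomial-pos {c = c} 0<c [] = small-const λ t _ → subst (0# <_) (solve 2 (λ c t → c := c :+ t :* con (ℤ.+ 0)) refl c t) 0<c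
  small-polynomial-pos {c = c} 0<c (b ∷ cs) = small-map
    (λ t 0<t (p , q) → subst (0# <_)
      (trans (solve 4 (λ c b t e → c :- t :* (con (ℤ.+ 1) :- b) :+ t :* (con (ℤ.+ 1) :+ t :* e) := c :+ t :* (b :+ t :* e)) refl c b t (eval cs t))
        (cong (λ z → c + t * z) (sym (eval-∷ b cs t))))
      (+-pos p (*-pos 0<t q)))
    (small-× (small-linear (1# − b) 0<c) (small-polynomial-pos 0<1 cs))

  -- Near zero the lowest nonzero coefficient decides the sign; a vanishing constant term is removed
  -- by factoring out `t`.
  small-polynomial-≢0 : ∀ c (cs : Vec ℝ k) → c ∷ cs ≢ origin → Small (λ t → c + t * eval cs t ≢ 0#)
  small-polynomial-≢0 c cs ≢0 with compare 0# c
  ... | tri< 0<c _ _ = small-map (λ t _ → 0<⇒≢0) (small-polynomial-pos 0<c cs)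
  ... | tri> _ _ c<0 = small-map
    (λ t _ p eq → 0<⇒≢0 p (trans (cong (λ z → - c + t * z) (⊛-∙ (- 1#) cs (powers _ t)))
        (trans (solve 3 (λ c t e → :- c :+ t :* ((:- con (ℤ.+ 1)) :* e) := :- (c :+ t :* e)) refl c t (eval cs t))
          (trans (cong -_ eq) Field.-0#≈0#))))
    (small-polynomial-pos (x<0⇒0<-x c<0) ((- 1#) ⊛ cs))
  small-polynomial-≢0 c [] ≢0 | tri≈ _ refl _ = contradiction refl ≢0
  small-polynomial-≢0 c (b ∷ cs) ≢0 | tri≈ _ refl _ = small-map
    (λ t 0<t p eq → 0<⇒≢0 0<t (*-cancel-0 (trans (sym (+-identityˡ _)) eq)
       (λ eq′ → p (trans (sym (eval-∷ b cs t)) eq′))))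
    (small-polynomial-≢0 b cs (λ eq → ≢0 (cong (0# ∷_) eq)))

  -- Affine functionals

  infix 7 _at_
  -- Homogeneous coordinates, with the constant term at the head: affine functionals become plain
  -- vectors, open to the linear algebra above.
  _at_ : Vec ℝ (suc d) → Point d → ℝ
  f at x = f ∙ (1# ∷ x)

  ⊕-at : ∀ a b (f g : Vec ℝ (suc d)) x → (a ⊛ f ⊕ b ⊛ g) at x ≡ a * (f at x) + b * (g at x)
  ⊕-at a b f g x = trans (⊕-∙ (a ⊛ f) (b ⊛ g) (1# ∷ x)) (cong₂ _+_ (⊛-∙ a f _) (⊛-∙ b g _))

  at-combination : ∀ b (c : Point d) (w : Vec ℝ m) ps → w ∙ map ((b ∷ c) at_) ps ≡ b * sum w + c ∙ combination w ps
  at-combination b c [] [] = sym (trans (cong₂ _+_ (zeroʳ b) (∙-origin c)) (+-identityˡ 0#))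
  at-combination b c (a ∷ w) (p ∷ ps) = begin
    a * (b * 1# + c ∙ p) + w ∙ map ((b ∷ c) at_) ps        ≡⟨ cong (a * (b * 1# + c ∙ p) +_) (at-combination b c w ps) ⟩
    a * (b * 1# + c ∙ p) + (b * sum w + c ∙ combination w ps)
      ≡⟨ solve 5 (λ a b s t r → a :* (b :* con (ℤ.+ 1) :+ t) :+ (b :* s :+ r) := b :* (a :+ s) :+ (a :* t :+ r)) refl a b (sum w) (c ∙ p) _ ⟩
    b * (a + sum w) + (a * (c ∙ p) + c ∙ combination w ps) ≡⟨ cong (λ z → b * (a + sum w) + (z + c ∙ combination w ps)) (∙-⊛ a c p) ⟨
    b * (a + sum w) + (c ∙ (a ⊛ p) + c ∙ combination w ps) ≡⟨ cong (b * (a + sum w) +_) (∙-⊕ c (a ⊛ p) _) ⟨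
    b * (a + sum w) + c ∙ (a ⊛ p ⊕ combination w ps)       ∎
    where open ≡-Reasoning

  at-affine-relation : ∀ (f : Vec ℝ (suc d)) (w : Vec ℝ m) ps → sum w ≡ 0# → combination w ps ≡ origin → w ∙ map (f at_) ps ≡ 0#
  at-affine-relation (b ∷ c) w ps Σw≡0 Σwp≡0 = trans (at-combination b c w ps)
    (trans (cong₂ _+_ (trans (cong (b *_) Σw≡0) (zeroʳ b)) (trans (cong (c ∙_) Σwp≡0) (∙-origin c))) (+-identityˡ 0#))

  ∙-vanishing : (w v : Vec ℝ m) → (∀ i → lookup w i * lookup v i ≡ 0#) → w ∙ v ≡ 0#
  ∙-vanishing [] [] _ = refl
  ∙-vanishing (a ∷ w) (b ∷ v) zeros = trans (cong₂ _+_ (zeros zero) (∙-vanishing w v (zeros ∘ suc))) (+-identityˡ 0#)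

  ∙-single : ∀ (w v : Vec ℝ m) j → (∀ i → i ≢ j → lookup w i * lookup v i ≡ 0#) → w ∙ v ≡ lookup w j * lookup v j
  ∙-single (a ∷ w) (b ∷ v) zero zeros = trans (cong (a * b +_) (∙-vanishing w v (λ i → zeros (suc i) λ ()))) (+-identityʳ _)
  ∙-single (a ∷ w) (b ∷ v) (suc j) zeros =
    trans (cong₂ _+_ (zeros zero λ ()) (∙-single w v j (λ i i≢j → zeros (suc i) (i≢j ∘ Fin.suc-injective)))) (+-identityˡ _)

  -- Simplicial facets and their stability

  -- `support` exposes exactly the points `p (l k)`. The functionals `dual` are their barycentric
  -- coordinates up to positive factors and so certify affine independence. All inequalities are
  -- strict, which is what makes the certificate stable.
  record SimplexFacet (p : Fin m → Point d) (l : Fin d → Fin m) : Set where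
    field
      support      : Vec ℝ (suc d)
      support-on   : ∀ k → support at p (l k) ≡ 0#
      support-off  : ∀ i → (∀ k → i ≢ l k) → 0# < support at p i
      dual         : Fin d → Vec ℝ (suc d)
      dual-off     : ∀ {k k′} → k′ ≢ k → dual k at p (l k′) ≡ 0#
      dual-on      : ∀ k → 0# < dual k at p (l k)

  -- Displacement along the moment curve, which lies in no hyperplane: every nonzero affine
  -- functional becomes a nonzero polynomial in `t`.
  shift : Point d → ℝ → Point d
  shift x t = x ⊕ t ⊛ powers _ t

  at-shift : ∀ (f : Vec ℝ (suc d)) x t → f at shift x t ≡ f at x + t * eval (tail f) t
  at-shift (b ∷ c) x t = begin
    b * 1# + c ∙ (x ⊕ t ⊛ powers _ t)             ≡⟨ cong (b * 1# +_) (∙-⊕ c x _) ⟩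
    b * 1# + (c ∙ x + c ∙ (t ⊛ powers _ t))       ≡⟨ cong (λ z → b * 1# + (c ∙ x + z)) (∙-⊛ t c _) ⟩
    b * 1# + (c ∙ x + t * eval c t)               ≡⟨ +-assoc _ _ _ ⟨
    b * 1# + c ∙ x + t * eval c t                 ∎
    where open ≡-Reasoning

  move : (Fin m → Point d) → Fin m → ℝ → Fin m → Point d
  move p i t j with j Fin.≟ i
  ... | yes _ = shift (p i) t
  ... | no  _ = p j

  move-moved : ∀ (p : Fin m → Point d) i t → move p i t i ≡ shift (p i) t
  move-moved p i t with i Fin.≟ i
  ... | yes _  = refl
  ... | no i≢i = contradiction refl i≢i

  move-fixed : ∀ (p : Fin m → Point d) {i j} t → j ≢ i → move p i t j ≡ p j
  move-fixed p {i} {j} t j≢i with j Fin.≟ i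
  ... | yes j≡i = contradiction j≡i j≢i
  ... | no _    = refl

  module _ {p : Fin m → Point d} {l : Fin d → Fin m} (facet : SimplexFacet p l) where
    open SimplexFacet facet

    -- Only the positivity of `support` at the moved point is at stake; the functionals and all
    -- their other values stay the same.
    facet-move-off : ∀ i → (∀ k → i ≢ l k) → Small (λ t → SimplexFacet (move p i t) l)
    facet-move-off i i∉l = small-map
      (λ t _ pos → record
        { support = support
        ; support-on = λ k → trans (cong (support at_) (fixed t k)) (support-on k)
        ; support-off = λ j j∉l → off t pos j j∉l (j Fin.≟ i)
        ; dual = dual
        ; dual-off = λ {k} {k′} k′≢k → trans (cong (dual k at_) (fixed t k′)) (dual-off k′≢k)
        ; dual-on = λ k → subst (λ x → 0# < dual k at x) (sym (fixed t k)) (dual-on k)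
        })
      (small-polynomial-pos (support-off i i∉l) (tail support))
      where
      fixed : ∀ t k → move p i t (l k) ≡ p (l k)
      fixed t k = move-fixed p t (i∉l k ∘ sym)
      off : ∀ t → 0# < support at p i + t * eval (tail support) t → ∀ j → (∀ k → j ≢ l k) → Dec (j ≡ i) → 0# < support at move p i t j
      off t pos j j∉l (yes refl) = subst (0# <_) (trans (sym (at-shift support (p i) t)) (cong (support at_) (sym (move-moved p i t)))) pos
      off t pos j j∉l (no j≢i) = subst (λ x → 0# < support at x) (sym (move-fixed p t j≢i)) (support-off j j∉l)

    module _ (l-inj : ∀ {k k′} → l k ≡ l k′ → k ≡ k′) (k₀ : Fin d) where
      private
        ψ = dual k₀
        moved : ℝ → Point d
        moved t = shift (p (l k₀)) t
        α : ℝ → ℝ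
        α t = ψ at moved t

        -- f corrected by a multiple of ψ so as to vanish at the moved vertex.
        correct : ℝ → Vec ℝ (suc d) → Vec ℝ (suc d)
        correct t f = α t ⊛ f ⊕ (- (f at moved t)) ⊛ ψ

        correct-moved : ∀ t f → correct t f at move p (l k₀) t (l k₀) ≡ 0#
        correct-moved t f = trans (cong (correct t f at_) (move-moved p (l k₀) t))
          (trans (⊕-at (α t) (- (f at moved t)) f ψ (moved t))
            (solve 2 (λ a b → a :* b :+ (:- b) :* a := con (ℤ.+ 0)) refl (α t) (f at moved t)))

        correct-fixed : ∀ t f {j} → j ≢ l k₀ →
          correct t f at move p (l k₀) t j ≡ α t * (f at p j) + (- (f at moved t)) * (ψ at p j)
        correct-fixed t f j≢ = trans (cong (correct t f at_) (move-fixed p t j≢)) (⊕-at (α t) (- (f at moved t)) f ψ _)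

        l≢ : ∀ {k k′} → k ≢ k′ → l k ≢ l k′
        l≢ k≢k′ = k≢k′ ∘ l-inj

        -- `ψ` vanishes at the other vertices, so there the correction merely rescales `f` by `α t`.
        correct-vertex : ∀ t f {k} → k ≢ k₀ → correct t f at move p (l k₀) t (l k) ≡ α t * (f at p (l k))
        correct-vertex t f {k} k≢ = trans (correct-fixed t f (l≢ k≢))
          (trans (cong (λ z → α t * (f at p (l k)) + (- (f at moved t)) * z) (dual-off k≢))
            (trans (cong (α t * (f at p (l k)) +_) (zeroʳ _)) (+-identityʳ _)))

        SupportOff : ℝ → Fin m → Set
        SupportOff t j = (∀ k → j ≢ l k) → 0# < α t * (support at p j) + (- (support at moved t)) * (ψ at p j)

        small-support-off : ∀ j → Small (λ t → SupportOff t j)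
        small-support-off j = small-→ (Fin.all? (λ k → ¬? (j Fin.≟ l k))) λ j∉l → small-map
          (λ t _ → subst (0# <_) (eq t))
          -- At `t = 0` the corrected value is `ψ at p (l k₀)` times `support at p j`, because
          -- `support` vanishes at `p (l k₀)`.
          (small-polynomial-pos (*-pos (dual-on k₀) (support-off j j∉l)) ((support at p j) ⊛ tail ψ ⊕ (- (ψ at p j)) ⊛ tail support))
          where
          eq : ∀ t → (ψ at p (l k₀)) * (support at p j) + t * eval ((support at p j) ⊛ tail ψ ⊕ (- (ψ at p j)) ⊛ tail support) t
               ≡ α t * (support at p j) + (- (support at moved t)) * (ψ at p j)
          eq t = begin
            a * s + t * eval (s ⊛ tail ψ ⊕ (- r) ⊛ tail support) t
              ≡⟨ cong (λ z → a * s + t * z) (trans (⊕-∙ (s ⊛ tail ψ) _ _) (cong₂ _+_ (⊛-∙ s (tail ψ) _) (⊛-∙ (- r) (tail support) _))) ⟩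
            a * s + t * (s * x + - r * y)
              ≡⟨ solve 6 (λ a s t x r y → a :* s :+ t :* (s :* x :+ :- r :* y) := (a :+ t :* x) :* s :+ (:- (con (ℤ.+ 0) :+ t :* y)) :* r) refl a s t x r y ⟩
            (a + t * x) * s + (- (0# + t * y)) * r
              ≡⟨ cong (λ z → (a + t * x) * s + (- (z + t * y)) * r) (support-on k₀) ⟨
            (a + t * x) * s + (- (support at p (l k₀) + t * y)) * r
              ≡⟨ cong₂ (λ u v → u * s + (- v) * r) (at-shift ψ (p (l k₀)) t) (at-shift support (p (l k₀)) t) ⟨
            α t * s + (- (support at moved t)) * r ∎
            where
            open ≡-Reasoning
            a = ψ at p (l k₀)
            s = support at p j
            r = ψ at p j
            x = eval (tail ψ) t
            y = eval (tail support) t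

        -- `ψ` itself is kept: it vanishes at the vertices that stay put, and at the moved one it
        -- has the positive value `α t`.
        newDual : ℝ → (k : Fin d) → Dec (k ≡ k₀) → Vec ℝ (suc d)
        newDual t k (yes _) = ψ
        newDual t k (no _)  = correct t (dual k)

      facet-move-on : Small (λ t → SimplexFacet (move p (l k₀) t) l)
      facet-move-on = small-map (λ t _ (α-pos , off) → build t (subst (0# <_) (sym (at-shift ψ (p (l k₀)) t)) α-pos) off)
        (small-× (small-polynomial-pos (dual-on k₀) (tail ψ)) (uniform-Fin small-support-off))
        where
        build : ∀ t → 0# < α t → (∀ j → SupportOff t j) → SimplexFacet (move p (l k₀) t) l
        build t α-pos off = record
          { support = correct t support
          ; support-on = λ k → on k (k Fin.≟ k₀)
          ; support-off = λ j j∉l → subst (0# <_) (sym (correct-fixed t support (j∉l k₀))) (off j j∉l)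
          ; dual = λ k → newDual t k (k Fin.≟ k₀)
          ; dual-off = λ {k} {k′} k′≢k → d-off k k′ k′≢k (k Fin.≟ k₀) (k′ Fin.≟ k₀)
          ; dual-on = λ k → d-on k (k Fin.≟ k₀)
          }
          where
          on : ∀ k → Dec (k ≡ k₀) → correct t support at move p (l k₀) t (l k) ≡ 0#
          on k (yes refl) = correct-moved t support
          on k (no k≢)    = trans (correct-vertex t support k≢) (trans (cong (α t *_) (support-on k)) (zeroʳ _))
          d-off : ∀ k k′ → k′ ≢ k → (e : Dec (k ≡ k₀)) → Dec (k′ ≡ k₀) → newDual t k e at move p (l k₀) t (l k′) ≡ 0#
          d-off k k′ k′≢k (yes refl) _ = trans (cong (ψ at_) (move-fixed p t (l≢ k′≢k))) (dual-off k′≢k)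
          d-off k k′ k′≢k (no _) (yes refl) = correct-moved t (dual k)
          d-off k k′ k′≢k (no _) (no k′≢) = trans (correct-vertex t (dual k) k′≢) (trans (cong (α t *_) (dual-off k′≢k)) (zeroʳ _))
          d-on : ∀ k → (e : Dec (k ≡ k₀)) → 0# < newDual t k e at move p (l k₀) t (l k)
          d-on k (yes refl) = subst (λ x → 0# < ψ at x) (sym (move-moved p (l k₀) t)) α-pos
          d-on k (no k≢) = subst (0# <_) (sym (correct-vertex t (dual k) k≢)) (*-pos α-pos (dual-on k))

    facet-move : (∀ {k k′} → l k ≡ l k′ → k ≡ k′) → ∀ i → Small (λ t → SimplexFacet (move p i t) l)
    facet-move l-inj i with Fin.any? (λ k → i Fin.≟ l k)
    ... | yes (k₀ , refl) = facet-move-on l-inj k₀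
    ... | no  i∉l         = facet-move-off i (λ k i≡lk → i∉l (k , i≡lk))

  -- General position

  count : Vec Bool m → ℕ
  count [] = 0
  count (true ∷ S) = suc (count S)
  count (false ∷ S) = count S

  select : (S : Vec Bool m) → Vec X m → Vec X (count S)
  select [] [] = []
  select (true ∷ S) (x ∷ xs) = x ∷ select S xs
  select (false ∷ S) (x ∷ xs) = select S xs

  select-lookup : ∀ (S : Vec Bool m) (xs : Vec X m) i → lookup S i ≡ true → Σ[ k ∈ Fin (count S) ] lookup (select S xs) k ≡ lookup xs i
  select-lookup (true ∷ S) (x ∷ xs) zero _ = zero , refl
  select-lookup (true ∷ S) (x ∷ xs) (suc i) eq = let k , eq′ = select-lookup S xs i eq in suc k , eq′
  select-lookup (false ∷ S) (x ∷ xs) (suc i) eq = select-lookup S xs i eq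

  count-remove : ∀ (S : Vec Bool m) i → lookup S i ≡ true → suc (count (S [ i ]≔ false)) ≡ count S
  count-remove (true ∷ S) zero _ = refl
  count-remove (true ∷ S) (suc i) eq = cong suc (count-remove S i eq)
  count-remove (false ∷ S) (suc i) eq = count-remove S i eq

  Supported : Vec ℝ m → Vec Bool m → Set
  Supported w S = ∀ i → lookup S i ≡ false → lookup w i ≡ 0#

  -- The weights run over all `m` points and vanish off `S`, so that neither moving a point nor
  -- shrinking `S` calls for reindexing.
  Independent : (Fin m → Point d) → Vec Bool m → Set
  Independent {m} p S = (w : Vec ℝ m) → Supported w S → sum w ≡ 0# → combination w (tabulate p) ≡ origin → w ≡ origin

  GeneralUpTo : ℕ → (Fin m → Point d) → Set
  GeneralUpTo {m} {d} b p = (S : Vec Bool m) → count S ℕ.≤ suc d → (∀ i → lookup S i ≡ true → toℕ i ℕ.< b) → Independent p S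

  GeneralPosition : (Fin m → Point d) → Set
  GeneralPosition {m} {d} p = (S : Vec Bool m) → count S ℕ.≤ suc d → Independent p S

  -- At most `d` linear conditions on the `d + 1` coefficients of `f`.
  hyperplane-through : (p : Fin m → Point d) (S : Vec Bool m) → count S ℕ.≤ d →
    Σ[ f ∈ Vec ℝ (suc d) ] f ≢ origin × (∀ i → lookup S i ≡ true → f at p i ≡ 0#)
  hyperplane-through p S |S|≤d =
    let es = select S (tabulate (λ i → 1# ∷ p i))
        f , f≢0 , solves = linear-system (ℕ.s≤s |S|≤d) (lookup es)
    in f , f≢0 , λ i i∈S → let k , eq = select-lookup S (tabulate (λ i → 1# ∷ p i)) i i∈S in
         trans (∙-comm f _) (trans (cong (_∙ f) (sym (trans eq (lookup∘tabulate _ i)))) (solves k))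

  -- The functional witnesses that `x` is outside the affine hull of the points of `S`.
  Avoids : (Fin m → Point d) → Point d → Vec Bool m → Set
  Avoids {m} {d} p x S = count S ℕ.≤ d → Σ[ f ∈ Vec ℝ (suc d) ] (∀ i → lookup S i ≡ true → f at p i ≡ 0#) × f at x ≢ 0#

  -- The hyperplane is fixed before `t`. Its functional along the curve is a nonzero polynomial,
  -- since a functional with zero linear part and zero value at `x` is zero.
  small-avoids : (p : Fin m → Point d) (x : Point d) (S : Vec Bool m) → Small (λ t → Avoids p (shift x t) S)
  small-avoids {d = d} p x S = small-→ (count S ℕ.≤? d) λ |S|≤d →
    let f , f≢0 , vanishes = hyperplane-through p S |S|≤d in
    small-map (λ t _ ≢0 → f , vanishes , λ eq → ≢0 (trans (sym (at-shift f x t)) eq))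
      (small-polynomial-≢0 (f at x) (tail f) (nonzero f f≢0))
    where
    nonzero : ∀ f → f ≢ origin → f at x ∷ tail f ≢ origin
    nonzero (b ∷ c) f≢0 eq with cong head eq | cong tail eq
    ... | eq₀ | refl = f≢0 (cong (_∷ origin) (trans (sym (trans (cong₂ _+_ (*-identityʳ b) (origin-∙ x)) (+-identityʳ b))) eq₀))

  combination-cong : ∀ (w : Vec ℝ m) {p q : Fin m → Point d} → (∀ i → lookup w i ≡ 0# ⊎ p i ≡ q i) →
    combination w (tabulate p) ≡ combination w (tabulate q)
  combination-cong [] eq = refl
  combination-cong (a ∷ w) {p} {q} eq = cong₂ _⊕_ (first (eq zero)) (combination-cong w (eq ∘ suc))
    where
    first : a ≡ 0# ⊎ p zero ≡ q zero → a ⊛ p zero ≡ a ⊛ q zero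
    first (inj₁ refl) = trans (0-⊛ (p zero)) (sym (0-⊛ (q zero)))
    first (inj₂ pq) = cong (a ⊛_) pq

  lookup-map-tabulate : ∀ (f : X → Y) (p : Fin m → X) i → lookup (map f (tabulate p)) i ≡ f (p i)
  lookup-map-tabulate f p i = trans (lookup-map i f (tabulate p)) (cong f (lookup∘tabulate p i))

  module _ (p : Fin m → Point d) (j : Fin m) (t : ℝ) (avoids : ∀ S → Avoids p (shift (p j) t) S) where
    private
      p′ = move p j t

    -- If `S` contains `j`, a functional that vanishes on the rest of `S` but not at the moved point
    -- forces the weight at `j` to be zero. What remains is a relation between earlier points, which
    -- have not moved in this step.
    general-step : GeneralUpTo (toℕ j) p → GeneralUpTo (suc (toℕ j)) p′
    general-step general S |S|≤1+d S≤j w w∈S Σw≡0 Σwp≡0 with lookup S j in Sj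
    ... | false = general S |S|≤1+d below w w∈S Σw≡0 (trans (sym (combination-cong w same)) Σwp≡0)
      where
      below : ∀ i → lookup S i ≡ true → toℕ i ℕ.< toℕ j
      below i Si = ℕ.≤∧≢⇒< (ℕ.≤-pred (S≤j i Si)) λ eq → case (trans (sym Si) (trans (cong (lookup S) (Fin.toℕ-injective eq)) Sj))
        where
        case : true ≢ false
        case ()
      same : ∀ i → lookup w i ≡ 0# ⊎ p′ i ≡ p i
      same i with i Fin.≟ j
      ... | yes refl = inj₁ (w∈S j Sj)
      ... | no i≢j   = inj₂ refl
    ... | true = general S⁻ (ℕ.≤-trans |S⁻|≤d (ℕ.n≤1+n d)) below w w∈S⁻ Σw≡0 (trans (sym (combination-cong w same)) Σwp≡0)
      where
      S⁻ = S [ j ]≔ false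
      |S⁻|≤d : count S⁻ ℕ.≤ d
      |S⁻|≤d = ℕ.≤-pred (subst (ℕ._≤ suc d) (sym (count-remove S j Sj)) |S|≤1+d)
      f = proj₁ (avoids S⁻ |S⁻|≤d)
      vanishes = proj₁ (proj₂ (avoids S⁻ |S⁻|≤d))
      f≢0 = proj₂ (proj₂ (avoids S⁻ |S⁻|≤d))
      terms : ∀ i → i ≢ j → lookup w i * lookup (map (f at_) (tabulate p′)) i ≡ 0#
      terms i i≢j with lookup S i in Si
      ... | false = trans (cong (_* lookup (map (f at_) (tabulate p′)) i) (w∈S i Si)) (zeroˡ _)
      ... | true = trans (cong (lookup w i *_) (trans (lookup-map-tabulate (f at_) p′ i)
          (trans (cong (f at_) (move-fixed p t i≢j)) (vanishes i (trans (lookup∘update′ i≢j S false) Si))))) (zeroʳ _)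
      wj≡0 : lookup w j ≡ 0#
      wj≡0 = *-cancel-0
        (trans (cong (lookup w j *_) (sym (trans (lookup-map-tabulate (f at_) p′ j) (cong (f at_) (move-moved p j t)))))
          (trans (sym (∙-single w (map (f at_) (tabulate p′)) j terms)) (at-affine-relation f w (tabulate p′) Σw≡0 Σwp≡0)))
        f≢0
      w∈S⁻ : Supported w S⁻
      w∈S⁻ i S⁻i with i Fin.≟ j
      ... | yes refl = wj≡0
      ... | no i≢j = w∈S i (trans (sym (lookup∘update′ i≢j S false)) S⁻i)
      below : ∀ i → lookup S⁻ i ≡ true → toℕ i ℕ.< toℕ j
      below i S⁻i with i Fin.≟ j
      ... | yes refl = contradiction (trans (sym S⁻i) (lookup∘update j S false)) λ ()
      ... | no i≢j = ℕ.≤∧≢⇒< (ℕ.≤-pred (S≤j i (trans (sym (lookup∘update′ i≢j S false)) S⁻i))) (i≢j ∘ Fin.toℕ-injective)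
      same : ∀ i → lookup w i ≡ 0# ⊎ p′ i ≡ p i
      same i with i Fin.≟ j
      ... | yes refl = inj₁ wj≡0
      ... | no i≢j   = inj₂ refl

  module _ {J : Set} (uniform-J : Uniform J) (l : J → Fin d → Fin m)
           {C : J → Set} (C? : ∀ j → Dec (C j)) (l-inj : ∀ j → C j → ∀ {k k′} → l j k ≡ l j k′ → k ≡ k′) where

    -- In the application `J` consists of all vectors over `Maybe (Fin D)`, where `Uniform` is
    -- available, and `C` says that a star occurs.
    AllFacets : (Fin m → Point d) → Set
    AllFacets p = ∀ j → C j → SimplexFacet p (l j)

    general-up-to : (p : Fin m → Point d) → AllFacets p → ∀ b → b ℕ.≤ m → Σ[ p′ ∈ (Fin m → Point d) ] AllFacets p′ × GeneralUpTo b p′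
    -- For `b = 0` the set `S` is empty, and `Supported` alone makes all weights vanish.
    general-up-to p facets zero _ = p , facets , λ S _ S<0 w w∈S _ _ →
      lookup-ext λ i → trans (w∈S i (¬-not λ Si → contradiction (S<0 i Si) λ ())) (sym (lookup-replicate i 0#))
    general-up-to p facets (suc b) b<m =
      let q , q-facets , q-general = general-up-to p facets b (ℕ.<⇒≤ b<m)
          j = fromℕ< b<m
          t , _ , t-facets , avoids = small-witness (small-×
            (uniform-J λ i → small-→ (C? i) λ c → facet-move (q-facets i c) (l-inj i c) j)
            (uniform-Vec uniform-Bool (small-avoids q (q j))))
      in move q j t , t-facets ,
         subst (λ b → GeneralUpTo (suc b) (move q j t)) (Fin.toℕ-fromℕ< b<m)
           (general-step q j t avoids (subst (λ b → GeneralUpTo b q) (sym (Fin.toℕ-fromℕ< b<m)) q-general))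

    perturb-to-general-position : (p : Fin m → Point d) → AllFacets p → Σ[ p′ ∈ (Fin m → Point d) ] AllFacets p′ × GeneralPosition p′
    perturb-to-general-position p facets =
      let p′ , facets′ , general = general-up-to p facets m ℕ.≤-refl in
      p′ , facets′ , λ S |S|≤1+d → general S |S|≤1+d (λ i _ → Fin.toℕ<n i)

  -- Inverses and leading coefficients

  infix 8 _⁻¹
  -- Total, with the default `0#` at `0#`, so that the coordinates attached to a vector can be
  -- defined before a star is known to occur in it.
  _⁻¹ : ℝ → ℝ
  x ⁻¹ with x ≟ 0#
  ... | yes _  = 0#
  ... | no x≢0 = proj₁ (inverse x x≢0)

  ⁻¹-inverse : ∀ {x} → x ≢ 0# → x * x ⁻¹ ≡ 1#
  ⁻¹-inverse {x} x≢0 with x ≟ 0#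
  ... | yes x≡0 = contradiction x≡0 x≢0
  ... | no x≢0′ = proj₂ (inverse x x≢0′)

  small-eval-≢0 : (cs : Vec ℝ k) → cs ≢ origin → Small (λ t → eval cs t ≢ 0#)
  small-eval-≢0 [] ≢0 = contradiction refl ≢0
  small-eval-≢0 (c ∷ cs) ≢0 = small-map (λ t _ p eq → p (trans (sym (eval-∷ c cs t)) eq)) (small-polynomial-≢0 c cs ≢0)

  -- For polynomials on `d` letters the two separated degrees are d-2 and d-1, the ones that no
  -- coordinate supplies as a power of `u`.
  split-leading : (cs : Vec ℝ (suc (suc k))) →
    Σ[ ds ∈ Vec ℝ k ] Σ[ a ∈ ℝ ] Σ[ b ∈ ℝ ] (∀ t → eval cs t ≡ eval ds t + t ^ k * (a + b * t))
  split-leading {zero} (a ∷ b ∷ []) = [] , a , b , λ t → trans (eval-∷ a (b ∷ []) t) (trans (cong (λ z → a + t * z) (eval-∷ b [] t))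
    (solve 3 (λ a b t → a :+ t :* (b :+ t :* con (ℤ.+ 0)) := con (ℤ.+ 0) :+ con (ℤ.+ 1) :* (a :+ b :* t)) refl a b t))
  split-leading {suc k} (c ∷ cs) = let ds , a , b , eq = split-leading cs in
    c ∷ ds , a , b , λ t → trans (eval-∷ c cs t) (trans (cong (λ z → c + t * z) (eq t))
      (trans (solve 6 (λ c t e p a b → c :+ t :* (e :+ p :* (a :+ b :* t)) := c :+ t :* e :+ t :* p :* (a :+ b :* t)) refl c t (eval ds t) (t ^ k) a b)
        (cong (_+ t * t ^ k * (a + b * t)) (sym (eval-∷ c ds t)))))

  -- Templates

  letter : Fin d → ℝ
  letter k = toℕ k ·1

  letter-injective : {j k : Fin d} → letter j ≡ letter k → j ≡ k
  letter-injective = Fin.toℕ-injective ∘ ·1-injective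

  fixedPart : (Fin d → ℝ) → Vec (Maybe (Fin d)) n → Vec ℝ n
  fixedPart g = map (maybe′ g 0#)

  starPart : Vec (Maybe (Fin d)) n → Vec ℝ n
  starPart = map (maybe′ (λ _ → 0#) 1#)

  ones : Vec ℝ n
  ones = replicate _ 1#

  -- Any linear statistic of the words on a line is affine in `g k`. Used with `letter` for `u` and
  -- `v₀`, and with the power `q` of the letter for `v₁`.
  word-on-line : ∀ (g : Fin d → ℝ) (τ : Vec (Maybe (Fin d)) n) k c →
    map g (map (fromMaybe k) τ) ∙ c ≡ fixedPart g τ ∙ c + g k * (starPart τ ∙ c)
  word-on-line g [] k [] = sym (trans (+-identityˡ _) (zeroʳ _))
  word-on-line g (just a ∷ τ) k (b ∷ c) = trans (cong (g a * b +_) (word-on-line g τ k c))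
    (solve 5 (λ a b s h t → a :* b :+ (s :+ h :* t) := a :* b :+ s :+ h :* (con (ℤ.+ 0) :* b :+ t)) refl (g a) b (fixedPart g τ ∙ c) (g k) (starPart τ ∙ c))
  word-on-line g (nothing ∷ τ) k (b ∷ c) = trans (cong (g k * b +_) (word-on-line g τ k c))
    (solve 4 (λ b s h t → h :* b :+ (s :+ h :* t) := con (ℤ.+ 0) :* b :+ s :+ h :* (con (ℤ.+ 1) :* b :+ t)) refl b (fixedPart g τ ∙ c) (g k) (starPart τ ∙ c))

  stars : Vec (Maybe (Fin d)) n → ℝ
  stars τ = starPart τ ∙ ones

  stars-nonneg : (τ : Vec (Maybe (Fin d)) n) → 0# ≤ stars τ
  stars-nonneg [] = inj₂ refl
  stars-nonneg (just a ∷ τ) = subst (0# ≤_) (sym (trans (cong (_+ stars τ) (zeroˡ 1#)) (+-identityˡ _))) (stars-nonneg τ)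
  stars-nonneg (nothing ∷ τ) = +-nonneg (inj₁ (subst (0# <_) (sym (*-identityˡ 1#)) 0<1)) (stars-nonneg τ)

  stars-pos : {τ : Vec (Maybe (Fin d)) n} → nothing ∈ᵛ τ → 0# < stars τ
  stars-pos {τ = nothing ∷ τ} (here refl) = subst (0# <_) (trans (+-comm _ _) (cong (_+ stars τ) (sym (*-identityˡ 1#)))) (0≤-+-0< (stars-nonneg τ) 0<1)
  stars-pos {τ = just a ∷ τ} (there p) = subst (0# <_) (sym (trans (cong (_+ stars τ) (zeroˡ 1#)) (+-identityˡ _))) (stars-pos p)
  stars-pos {τ = nothing ∷ τ} (there p) = stars-pos {τ = nothing ∷ τ} (here refl)

  -- The entries are `B (x − a)` at a fixed letter `a` and `B x − U` at a star. If all vanish and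
  -- `B` is nonzero, the fixed letters agree and every star carries the same letter `U / B`.
  deviation : ℝ → ℝ → Vec (Maybe (Fin d)) n → Vec (Fin d) n → Vec ℝ n
  deviation B U τ x = B ⊛ (map letter x ⊕ (- 1#) ⊛ fixedPart letter τ) ⊕ (- U) ⊛ starPart τ

  deviation-∙ : ∀ B U (τ : Vec (Maybe (Fin d)) n) x c →
    deviation B U τ x ∙ c ≡ B * (map letter x ∙ c − fixedPart letter τ ∙ c) − U * (starPart τ ∙ c)
  deviation-∙ B U τ x c = begin
    deviation B U τ x ∙ c
      ≡⟨ ⊕-∙ (B ⊛ (map letter x ⊕ (- 1#) ⊛ fixedPart letter τ)) ((- U) ⊛ starPart τ) c ⟩
    (B ⊛ (map letter x ⊕ (- 1#) ⊛ fixedPart letter τ)) ∙ c + ((- U) ⊛ starPart τ) ∙ c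
      ≡⟨ cong₂ _+_ (trans (⊛-∙ B (map letter x ⊕ (- 1#) ⊛ fixedPart letter τ) c) (cong (B *_) (trans (⊕-∙ (map letter x) ((- 1#) ⊛ fixedPart letter τ) c) (cong (map letter x ∙ c +_) (⊛-∙ (- 1#) (fixedPart letter τ) c))))) (⊛-∙ (- U) (starPart τ) c) ⟩
    B * (map letter x ∙ c + - 1# * (fixedPart letter τ ∙ c)) + - U * (starPart τ ∙ c)
      ≡⟨ solve 5 (λ B U x f s → B :* (x :+ :- con (ℤ.+ 1) :* f) :+ :- U :* s := B :* (x :- f) :- U :* s) refl B U _ _ _ ⟩
    B * (map letter x ∙ c − fixedPart letter τ ∙ c) − U * (starPart τ ∙ c) ∎
    where open ≡-Reasoning

  deviation-letter : ∀ {B U} {τ : Vec (Maybe (Fin d)) n} {x} → nothing ∈ᵛ τ → deviation B U τ x ≡ origin → Σ[ k ∈ Fin d ] B * letter k ≡ U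
  deviation-letter {B = B} {U} {nothing ∷ τ} {x ∷ xs} (here refl) eq = x , Field.x∙y⁻¹≈ε⇒x≈y _ _ (trans
    (solve 3 (λ B x U → B :* x :- U := B :* (x :+ :- con (ℤ.+ 1) :* con (ℤ.+ 0)) :+ :- U :* con (ℤ.+ 1)) refl B (letter x) U) (cong head eq))
  deviation-letter {τ = _ ∷ τ} {x ∷ xs} (there p) eq = deviation-letter {τ = τ} {xs} p (cong tail eq)

  deviation-zero : ∀ {B U} (τ : Vec (Maybe (Fin d)) n) x k → B ≢ 0# → B * letter k ≡ U → deviation B U τ x ≡ origin → x ≡ map (fromMaybe k) τ
  deviation-zero [] [] k B≢0 Bk≡U eq = refl
  deviation-zero {B = B} {U} (just a ∷ τ) (x ∷ xs) k B≢0 Bk≡U eq = cong₂ _∷_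
    (letter-injective (Field.x∙y⁻¹≈ε⇒x≈y _ _ (*-cancel-0 (trans
      (solve 4 (λ B x a U → (x :- a) :* B := B :* (x :+ :- con (ℤ.+ 1) :* a) :+ :- U :* con (ℤ.+ 0)) refl B (letter x) (letter a) U) (cong head eq)) B≢0)))
    (deviation-zero τ xs k B≢0 Bk≡U (cong tail eq))
  deviation-zero {B = B} (nothing ∷ τ) (x ∷ xs) k B≢0 refl eq = cong₂ _∷_
    (letter-injective (Field.x∙y⁻¹≈ε⇒x≈y _ _ (*-cancel-0 (trans
      (solve 3 (λ B x k → (x :- k) :* B := B :* (x :+ :- con (ℤ.+ 1) :* con (ℤ.+ 0)) :+ :- (B :* k) :* con (ℤ.+ 1)) refl B (letter x) (letter k)) (cong head eq)) B≢0)))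
    (deviation-zero τ xs k B≢0 refl (cong tail eq))

  abstract
    interpolate-letters : ∀ e (y : Fin (5 ℕ.+ e) → ℝ) →
      Σ[ cs ∈ Vec ℝ (3 ℕ.+ e) ] Σ[ a ∈ ℝ ] Σ[ b ∈ ℝ ] (∀ k → eval cs (letter k) + letter k ^ (3 ℕ.+ e) * (a + b * letter k) ≡ y k)
    interpolate-letters e y =
      let cs , cs-eq = interpolate letter letter-injective y
          ds , a , b , eq = split-leading cs
      in ds , a , b , λ k → trans (sym (eq (letter k))) (cs-eq k)

  -- The initial configuration

  module Configuration (e n : ℕ) (s ε : ℝ) where
    q D : ℕ
    q = 3 ℕ.+ e
    D = 5 ℕ.+ e

    letter^q : Fin D → ℝ
    letter^q k = letter k ^ q

    u v₀ v₁ v : Word D n → ℝ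
    u  x = map letter x ∙ ones
    v₀ x = eval (map letter x) s
    v₁ x = map letter^q x ∙ ones
    v  x = v₀ x + ε * v₁ x

    point : Word D n → Point D
    point x = v x ∷ u x * v x ∷ v x * v x ∷ u x ⊛ powers (2 ℕ.+ e) (u x)

    functional-uv : ∀ a b c (cs : Vec ℝ q) →
      Σ[ f ∈ Vec ℝ (suc D) ] (∀ x → f at point x ≡ c * (v x * v x) + (a + b * u x) * v x + eval cs (u x))
    functional-uv a b c (c₀ ∷ cs) = c₀ ∷ a ∷ b ∷ c ∷ cs , λ x →
      solve 7 (λ a b c k u v t → k :+ (a :* v :+ (b :* (u :* v) :+ (c :* (v :* v) :+ t))) := c :* (v :* v) :+ (a :+ b :* u) :* v :+ (k :+ t))
        refl a b c (c₀ * 1#) (u x) (v x) (cs ∙ (u x ⊛ powers _ (u x)))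

    abstract
      -- An affine change of coordinates from (u,v) to (κ,ℓ) keeps the space of functionals. The
      -- square of `ℓ` produces a term in u², which fits because `q` is at least 3; this is where d
      -- ≥ 5 enters.
      functional-κℓ : ∀ a₀ b₀ g h a b c (cs : Vec ℝ q) →
        Σ[ f ∈ Vec ℝ (suc D) ] (∀ x → let κ = a₀ + b₀ * u x ; ℓ = v x + (g + h * u x) in
          f at point x ≡ c * (ℓ * ℓ) + (a + b * κ) * ℓ + eval cs κ)
      functional-κℓ a₀ b₀ g h a b c cs =
        let ds , ds-eq = substitute-linear a₀ b₀ cs
            -- With y = g + h u and m = m₀ + m₁ u = c y + a + b κ, the quadratic part expands to c
            -- v² + (m + c y) v + m y; `qs` lists the coefficients of m y.
            m₀ = c * g + a + b * a₀
            m₁ = c * h + b * b₀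
            qs = m₀ * g ∷ m₀ * h + m₁ * g ∷ m₁ * h ∷ origin
            f , f-eq = functional-uv (m₀ + c * g) (m₁ + c * h) c (qs ⊕ ds)
        in f , λ x → begin
          f at point x
            ≡⟨ f-eq x ⟩
          c * (v x * v x) + (m₀ + c * g + (m₁ + c * h) * u x) * v x + eval (qs ⊕ ds) (u x)
            ≡⟨ cong (c * (v x * v x) + (m₀ + c * g + (m₁ + c * h) * u x) * v x +_)
                 (trans (⊕-∙ qs ds (powers q (u x))) (cong₂ _+_ (quadratic (m₀ * g) (m₀ * h + m₁ * g) (m₁ * h) (u x)) (ds-eq (u x)))) ⟩
          c * (v x * v x) + (m₀ + c * g + (m₁ + c * h) * u x) * v x + (m₀ * g + u x * (m₀ * h + m₁ * g + u x * (m₁ * h)) + eval cs (a₀ + b₀ * u x))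
            ≡⟨ solve 10 (λ a₀ b₀ g h a b c u v t →
                 let m₀ = c :* g :+ a :+ b :* a₀
                     m₁ = c :* h :+ b :* b₀
                     κ = a₀ :+ b₀ :* u
                     ℓ = v :+ (g :+ h :* u)
                 in c :* (v :* v) :+ (m₀ :+ c :* g :+ (m₁ :+ c :* h) :* u) :* v :+ (m₀ :* g :+ u :* (m₀ :* h :+ m₁ :* g :+ u :* (m₁ :* h)) :+ t)
                    := c :* (ℓ :* ℓ) :+ (a :+ b :* κ) :* ℓ :+ t)
                 refl a₀ b₀ g h a b c (u x) (v x) (eval cs (a₀ + b₀ * u x)) ⟩
          c * ((v x + (g + h * u x)) * (v x + (g + h * u x))) + (a + b * (a₀ + b₀ * u x)) * (v x + (g + h * u x)) + eval cs (a₀ + b₀ * u x) ∎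
        where
        open ≡-Reasoning
        quadratic : ∀ a b c t → eval (a ∷ b ∷ c ∷ origin {e}) t ≡ a + t * (b + t * c)
        quadratic a b c t = begin
          eval (a ∷ b ∷ c ∷ O) t               ≡⟨ eval-∷ a (b ∷ c ∷ O) t ⟩
          a + t * eval (b ∷ c ∷ O) t           ≡⟨ cong (λ z → a + t * z) (eval-∷ b (c ∷ O) t) ⟩
          a + t * (b + t * eval (c ∷ O) t)     ≡⟨ cong (λ z → a + t * (b + t * z)) (eval-∷ c O t) ⟩
          a + t * (b + t * (c + t * eval O t)) ≡⟨ cong (λ z → a + t * (b + t * (c + t * z))) (origin-∙ (powers e t)) ⟩
          a + t * (b + t * (c + t * 0#))       ≡⟨ cong (λ z → a + t * (b + t * z)) (trans (cong (c +_) (zeroʳ t)) (+-identityʳ c)) ⟩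
          a + t * (b + t * c)                  ∎
          where
          O : Vec ℝ e
          O = origin

    square = interpolate-letters e (λ k → letter k ^ q * letter k ^ q)
    low = proj₁ square
    r₀ = proj₁ (proj₂ square)
    r₁ = proj₁ (proj₂ (proj₂ square))

    module OfTemplate (τ : Vec (Maybe (Fin D)) n) where
      A B C C′ S H : ℝ
      A  = fixedPart letter τ ∙ ones
      B  = stars τ
      C  = eval (fixedPart letter τ) s
      C′ = fixedPart letter^q τ ∙ ones
      S  = eval (starPart τ) s
      H  = B ⁻¹

      -- On the line of τ, κ is the letter k put in place of the stars and ℓ = ε B k^q.
      κ ℓ₀ ℓ₁ ℓ : Word D n → ℝ
      κ  x = - (A * H) + H * u x
      ℓ₀ x = v₀ x − C − S * κ x
      ℓ₁ x = v₁ x − C′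
      ℓ  x = v x + (- (C + ε * C′ − S * (A * H)) + - (S * H) * u x)

      ℓ-split : ∀ x → ℓ x ≡ ℓ₀ x + ε * ℓ₁ x
      ℓ-split x = solve 9 (λ v₀ v₁ ε C C′ S A H u →
          v₀ :+ ε :* v₁ :+ (:- (C :+ ε :* C′ :- S :* (A :* H)) :+ :- (S :* H) :* u)
          := v₀ :- C :- S :* (:- (A :* H) :+ H :* u) :+ ε :* (v₁ :- C′))
        refl (v₀ x) (v₁ x) ε C C′ S A H (u x)

      functional : ∀ a b c (cs : Vec ℝ q) →
        Σ[ f ∈ Vec ℝ (suc D) ] (∀ x → f at point x ≡ c * (ℓ x * ℓ x) + (a + b * κ x) * ℓ x + eval cs (κ x))
      functional = functional-κℓ (- (A * H)) H (- (C + ε * C′ − S * (A * H))) (- (S * H))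

      -- On the letters, k^(2q) = low(k) + k^q (r₀ + r₁ k); this makes the corrected ℓ² vanish on the line.
      Φ : Word D n → ℝ
      Φ x = 1# * (ℓ x * ℓ x) + (- (ε * B * r₀) + - (ε * B * r₁) * κ x) * ℓ x + eval ((- (ε * B * (ε * B))) ⊛ low) (κ x)

      -- The coefficients of B ℓ₀ as a polynomial in s; they all vanish only on the line.
      Dev : Word D n → Vec ℝ n
      Dev x = deviation B (u x − A) τ x

      module _ (star : nothing ∈ᵛ τ) where
        B-pos : 0# < B
        B-pos = stars-pos star

        BH≡1 : B * H ≡ 1#
        BH≡1 = ⁻¹-inverse (0<⇒≢0 B-pos)

        κ-on : ∀ k → κ (map (fromMaybe k) τ) ≡ letter k
        κ-on k = trans (cong (λ z → - (A * H) + H * z) (word-on-line letter τ k ones))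
          (trans (solve 4 (λ A H B k → :- (A :* H) :+ H :* (A :+ k :* B) := k :* (B :* H)) refl A H B (letter k))
            (trans (cong (letter k *_) BH≡1) (*-identityʳ _)))

        ℓ-on : ∀ k → ℓ (map (fromMaybe k) τ) ≡ ε * B * letter k ^ q
        ℓ-on k = trans (ℓ-split x) (trans
          (cong₂ (λ y z → y + ε * z)
            (cong₂ (λ y z → y − C − S * z) (word-on-line letter τ k (powers n s)) (κ-on k))
            (cong (_− C′) (word-on-line letter^q τ k ones)))
          (solve 7 (λ C S k ε C′ B z → C :+ k :* S :- C :- S :* k :+ ε :* (C′ :+ z :* B :- C′) := ε :* B :* z) refl C S (letter k) ε C′ B (letter k ^ q)))
          where x = map (fromMaybe k) τ

        Φ-on : ∀ k → Φ (map (fromMaybe k) τ) ≡ 0#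
        Φ-on k = begin
          Φ x
            ≡⟨ cong₂ (λ y z → 1# * (y * y) + (- (ε * B * r₀) + - (ε * B * r₁) * z) * y + eval ((- (ε * B * (ε * B))) ⊛ low) z) (ℓ-on k) (κ-on k) ⟩
          1# * (ε * B * t * (ε * B * t)) + (- (ε * B * r₀) + - (ε * B * r₁) * letter k) * (ε * B * t) + eval ((- (ε * B * (ε * B))) ⊛ low) (letter k)
            ≡⟨ cong (1# * (ε * B * t * (ε * B * t)) + (- (ε * B * r₀) + - (ε * B * r₁) * letter k) * (ε * B * t) +_) (⊛-∙ (- (ε * B * (ε * B))) low (powers q (letter k))) ⟩
          1# * (ε * B * t * (ε * B * t)) + (- (ε * B * r₀) + - (ε * B * r₁) * letter k) * (ε * B * t) + - (ε * B * (ε * B)) * eval low (letter k)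
            ≡⟨ solve 6 (λ b t r₀ r₁ k z → con (ℤ.+ 1) :* (b :* t :* (b :* t)) :+ (:- (b :* r₀) :+ :- (b :* r₁) :* k) :* (b :* t) :+ :- (b :* b) :* z
                  := b :* b :* (t :* t :- (z :+ t :* (r₀ :+ r₁ :* k)))) refl (ε * B) t r₀ r₁ (letter k) (eval low (letter k)) ⟩
          ε * B * (ε * B) * (t * t − (eval low (letter k) + t * (r₀ + r₁ * letter k)))
            ≡⟨ cong (λ z → ε * B * (ε * B) * (t * t − z)) (proj₂ (proj₂ (proj₂ square)) k) ⟩
          ε * B * (ε * B) * (t * t − t * t)
            ≡⟨ trans (cong (ε * B * (ε * B) *_) (-‿inverseʳ (t * t))) (zeroʳ _) ⟩
          0# ∎
          where
          open ≡-Reasoning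
          x = map (fromMaybe k) τ
          t = letter k ^ q

        ℓ₀-off : ∀ x → (∀ k → x ≢ map (fromMaybe k) τ) → (Dev x ≢ origin → eval (Dev x) s ≢ 0#) → ℓ₀ x ≢ 0#
        ℓ₀-off x x∉L s-generic ℓ₀≡0 = s-generic Dev≢0 (trans Dev-eval (trans (cong (B *_) ℓ₀≡0) (zeroʳ B)))
          where
          Dev≢0 : Dev x ≢ origin
          Dev≢0 eq = let k , Bk≡U = deviation-letter {τ = τ} {x} star eq in
            x∉L k (deviation-zero τ x k (0<⇒≢0 B-pos) Bk≡U eq)
          Dev-eval : eval (Dev x) s ≡ B * ℓ₀ x
          Dev-eval = begin
            eval (Dev x) s                                       ≡⟨ deviation-∙ B (u x − A) τ x (powers n s) ⟩
            B * (v₀ x − C) − (u x − A) * S                       ≡⟨ cong (λ z → B * (v₀ x − C) − z * S) (*-identityˡ (u x − A)) ⟨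
            B * (v₀ x − C) − 1# * (u x − A) * S                  ≡⟨ cong (λ z → B * (v₀ x − C) − z * (u x − A) * S) BH≡1 ⟨
            B * (v₀ x − C) − B * H * (u x − A) * S               ≡⟨ solve 7 (λ B v C H u A S → B :* (v :- C) :- B :* H :* (u :- A) :* S := B :* (v :- C :- S :* (:- (A :* H) :+ H :* u))) refl B (v₀ x) C H (u x) A S ⟩
            B * ℓ₀ x                                             ∎
            where open ≡-Reasoning

        indicator : Fin D → Fin D → ℝ
        indicator k j with j Fin.≟ k
        ... | yes _ = 1#
        ... | no _  = 0#

        abstract
          -- On the line `ℓ` is `ε * B` times the power `q` of the letter. Giving the low-degree
          -- part the same factor turns an interpolant of `indicator k` into a functional; at ε = 0
          -- its values on the line would all be zero.
          dualFunctional : ∀ k → Σ[ f ∈ Vec ℝ (suc D) ] (∀ j → f at point (map (fromMaybe j) τ) ≡ ε * B * indicator k j)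
          dualFunctional k =
            let cs , a , b , eq = interpolate-letters e (indicator k)
                f , f-eq = functional a b 0# ((ε * B) ⊛ cs)
            in f , λ j → let t = letter j ^ q ; x = map (fromMaybe j) τ in begin
              f at point x
                ≡⟨ f-eq x ⟩
              0# * (ℓ x * ℓ x) + (a + b * κ x) * ℓ x + eval ((ε * B) ⊛ cs) (κ x)
                ≡⟨ cong₂ (λ y z → 0# * (y * y) + (a + b * z) * y + eval ((ε * B) ⊛ cs) z) (ℓ-on j) (κ-on j) ⟩
              0# * (ε * B * t * (ε * B * t)) + (a + b * letter j) * (ε * B * t) + eval ((ε * B) ⊛ cs) (letter j)
                ≡⟨ cong (0# * (ε * B * t * (ε * B * t)) + (a + b * letter j) * (ε * B * t) +_) (⊛-∙ (ε * B) cs (powers q (letter j))) ⟩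
              0# * (ε * B * t * (ε * B * t)) + (a + b * letter j) * (ε * B * t) + ε * B * eval cs (letter j)
                ≡⟨ solve 6 (λ c t a b k z → con (ℤ.+ 0) :* (c :* t :* (c :* t)) :+ (a :+ b :* k) :* (c :* t) :+ c :* z := c :* (z :+ t :* (a :+ b :* k)))
                     refl (ε * B) t a b (letter j) (eval cs (letter j)) ⟩
              ε * B * (eval cs (letter j) + t * (a + b * letter j))
                ≡⟨ cong (ε * B *_) (eq j) ⟩
              ε * B * indicator k j ∎
            where open ≡-Reasoning

        initial-facet : ∀ {m} (decode : Fin m → Word D n) (encode : Word D n → Fin m) →
          (∀ x → decode (encode x) ≡ x) → (∀ i → encode (decode i) ≡ i) →
          0# < ε → (∀ x → (∀ k → x ≢ map (fromMaybe k) τ) → 0# < Φ x) →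
          SimplexFacet (point ∘ decode) (λ k → encode (map (fromMaybe k) τ))
        initial-facet decode encode decode-encode encode-decode ε-pos Φ-off = record
          { support     = proj₁ Φ-functional
          ; support-on  = λ k → trans (proj₂ Φ-functional (decode (encode (map (fromMaybe k) τ)))) (trans (cong Φ (decode-encode (map (fromMaybe k) τ))) (Φ-on k))
          ; support-off = λ i i∉l → subst (0# <_) (sym (proj₂ Φ-functional (decode i)))
              (Φ-off (decode i) λ k eq → i∉l k (trans (sym (encode-decode i)) (cong encode eq)))
          ; dual        = λ k → proj₁ (dualFunctional k)
          ; dual-off    = λ {k} {k′} k′≢k → trans (dual-value k k′) (trans (cong (ε * B *_) (indicator-off k′≢k)) (zeroʳ _))
          ; dual-on     = λ k → subst (0# <_) (sym (trans (dual-value k k) (trans (cong (ε * B *_) (indicator-on k)) (*-identityʳ _)))) (*-pos ε-pos B-pos)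
          }
          where
          Φ-functional : Σ[ f ∈ Vec ℝ (suc D) ] (∀ x → f at point x ≡ Φ x)
          Φ-functional = functional (- (ε * B * r₀)) (- (ε * B * r₁)) 1# ((- (ε * B * (ε * B))) ⊛ low)
          dual-value : ∀ k j → proj₁ (dualFunctional k) at point (decode (encode (map (fromMaybe j) τ))) ≡ ε * B * indicator k j
          dual-value k j = trans (cong (λ x → proj₁ (dualFunctional k) at point x) (decode-encode (map (fromMaybe j) τ))) (proj₂ (dualFunctional k) j)
          indicator-off : ∀ {k j} → j ≢ k → indicator k j ≡ 0#
          indicator-off {k} {j} j≢k with j Fin.≟ k
          ... | yes j≡k = contradiction j≡k j≢k
          ... | no _    = refl
          indicator-on : ∀ k → indicator k k ≡ 1#
          indicator-on k with k Fin.≟ k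
          ... | yes _  = refl
          ... | no k≢k = contradiction refl k≢k

  module _ (e n : ℕ) where
    private
      module Conf (s ε : ℝ) (τ : Vec (Maybe (Fin (5 ℕ.+ e))) n) = Configuration.OfTemplate e n s ε τ

    -- Every correction in `Φ` carries a factor `ε`, so as a polynomial in `ε` it has the square of
    -- `ℓ₀ x` as constant term. The quantities taken at `0#` do not involve `ε`.
    small-Φ : ∀ s τ x → Conf.ℓ₀ s 0# τ x ≢ 0# → Small (λ ε → 0# < Conf.Φ s ε τ x)
    small-Φ s τ x ℓ₀≢0 = small-map (λ ε _ → subst (0# <_) (eq ε)) (small-polynomial-pos (x≢0⇒0<x² ℓ₀≢0) (c₁ ∷ c₂ ∷ []))
      where
      open Configuration e n s 0# using (r₀; r₁; low; q)
      open Conf s 0# τ using (κ; ℓ₀; ℓ₁; B)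
      ρ = r₀ + r₁ * κ x
      z = eval low (κ x)
      c₁ = ℓ₀ x * ℓ₁ x + ℓ₀ x * ℓ₁ x − B * ρ * ℓ₀ x
      c₂ = ℓ₁ x * ℓ₁ x − B * ρ * ℓ₁ x − B * B * z
      eq : ∀ ε → ℓ₀ x * ℓ₀ x + ε * eval (c₁ ∷ c₂ ∷ []) ε ≡ Conf.Φ s ε τ x
      eq ε = begin
        ℓ₀ x * ℓ₀ x + ε * eval (c₁ ∷ c₂ ∷ []) ε
          ≡⟨ cong (λ y → ℓ₀ x * ℓ₀ x + ε * y) (trans (eval-∷ c₁ (c₂ ∷ []) ε) (cong (λ y → c₁ + ε * y) (eval-∷ c₂ [] ε))) ⟩
        ℓ₀ x * ℓ₀ x + ε * (c₁ + ε * (c₂ + ε * 0#))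
          ≡⟨ solve 8 (λ ε a b B r₀ r₁ k z →
               let ρ = r₀ :+ r₁ :* k
                   ℓ = a :+ ε :* b
               in a :* a :+ ε :* (a :* b :+ a :* b :- B :* ρ :* a :+ ε :* (b :* b :- B :* ρ :* b :- B :* B :* z :+ ε :* con (ℤ.+ 0)))
                  := con (ℤ.+ 1) :* (ℓ :* ℓ) :+ (:- (ε :* B :* r₀) :+ :- (ε :* B :* r₁) :* k) :* ℓ :+ :- (ε :* B :* (ε :* B)) :* z)
               refl ε (ℓ₀ x) (ℓ₁ x) B r₀ r₁ (κ x) z ⟩
        1# * ((ℓ₀ x + ε * ℓ₁ x) * (ℓ₀ x + ε * ℓ₁ x)) + (- (ε * B * r₀) + - (ε * B * r₁) * κ x) * (ℓ₀ x + ε * ℓ₁ x) + - (ε * B * (ε * B)) * z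
          ≡⟨ cong₂ (λ y w → 1# * (y * y) + (- (ε * B * r₀) + - (ε * B * r₁) * κ x) * y + w) (Conf.ℓ-split s ε τ x) (⊛-∙ (- (ε * B * (ε * B))) low (powers q (κ x))) ⟨
        Conf.Φ s ε τ x ∎
        where open ≡-Reasoning

    private
      -- `Dev` involves neither `s` nor `ε`, hence the placeholders `0#`: the polynomial is known
      -- before an `s` is chosen that misses its roots.
      Generic : ℝ → Vec (Maybe (Fin (5 ℕ.+ e))) n → Word (5 ℕ.+ e) n → Set
      Generic s τ x = Conf.Dev 0# 0# τ x ≢ origin → eval (Conf.Dev 0# 0# τ x) s ≢ 0#

      small-generic : Small (λ s → ∀ τ x → Generic s τ x)
      small-generic = uniform-Vec (uniform-Maybe uniform-Fin) {λ τ s → ∀ x → Generic s τ x} λ τ →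
        uniform-Vec uniform-Fin {λ x s → Generic s τ x} λ x →
          small-→ (¬? (≡-dec _≟_ (Conf.Dev 0# 0# τ x) origin)) (small-eval-≢0 (Conf.Dev 0# 0# τ x))

      Supporting : ℝ → ℝ → Vec (Maybe (Fin (5 ℕ.+ e))) n → Word (5 ℕ.+ e) n → Set
      Supporting s ε τ x = Conf.ℓ₀ s 0# τ x ≢ 0# → 0# < Conf.Φ s ε τ x

      -- `s` is fixed beforehand, since the threshold for `ε` depends on `ℓ₀` and thereby on `s`.
      small-supporting : ∀ s → Small (λ ε → ∀ τ x → Supporting s ε τ x)
      small-supporting s = uniform-Vec (uniform-Maybe uniform-Fin) {λ τ ε → ∀ x → Supporting s ε τ x} λ τ →
        uniform-Vec uniform-Fin {λ x ε → Supporting s ε τ x} λ x →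
          small-→ (¬? (Conf.ℓ₀ s 0# τ x ≟ 0#)) (small-Φ s τ x)

    module _ {m : ℕ} (decode : Fin m → Word (5 ℕ.+ e) n) (encode : Word (5 ℕ.+ e) n → Fin m)
             (decode-encode : ∀ x → decode (encode x) ≡ x) (encode-decode : ∀ i → encode (decode i) ≡ i) where

      InitialConfiguration : Set
      InitialConfiguration = Σ[ p ∈ (Fin m → Point (5 ℕ.+ e)) ] (∀ τ → nothing ∈ᵛ τ → SimplexFacet p (λ k → encode (map (fromMaybe k) τ)))

      private
        configuration : ∀ s → (∀ τ x → Generic s τ x) → ∀ ε → 0# < ε → (∀ τ x → Supporting s ε τ x) → InitialConfiguration
        configuration s generic ε ε-pos supporting = Configuration.point e n s ε ∘ decode , λ τ star →
          Conf.initial-facet s ε τ star decode encode decode-encode encode-decode ε-pos λ x x∉L →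
            supporting τ x (Conf.ℓ₀-off s ε τ star x x∉L (generic τ x))

      initial-configuration : InitialConfiguration
      initial-configuration =
        let s , _ , generic = small-witness small-generic
            ε , ε-pos , supporting = small-witness (small-supporting s)
        in configuration s generic ε ε-pos supporting

  -- Linearity of weighted combinations

  ⊕-identityˡ : (x : Point N) → origin ⊕ x ≡ x
  ⊕-identityˡ [] = refl
  ⊕-identityˡ (a ∷ x) = cong₂ _∷_ (+-identityˡ a) (⊕-identityˡ x)

  ⊕-identityʳ : (x : Point N) → x ⊕ origin ≡ x
  ⊕-identityʳ [] = refl
  ⊕-identityʳ (a ∷ x) = cong₂ _∷_ (+-identityʳ a) (⊕-identityʳ x)

  1-⊛ : (x : Point N) → 1# ⊛ x ≡ x
  1-⊛ [] = refl
  1-⊛ (a ∷ x) = cong₂ _∷_ (*-identityˡ a) (1-⊛ x)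

  ⊛-origin : ∀ a → a ⊛ origin {N} ≡ origin
  ⊛-origin {zero} a = refl
  ⊛-origin {suc N} a = cong₂ _∷_ (zeroʳ a) (⊛-origin a)

  ⊕-⊛-regroup : ∀ a b c (x y z : Point N) → (a * b + c) ⊛ x ⊕ (a ⊛ y ⊕ z) ≡ a ⊛ (b ⊛ x ⊕ y) ⊕ (c ⊛ x ⊕ z)
  ⊕-⊛-regroup a b c [] [] [] = refl
  ⊕-⊛-regroup a b c (x ∷ xs) (y ∷ ys) (z ∷ zs) = cong₂ _∷_
    (solve 6 (λ a b c x y z → (a :* b :+ c) :* x :+ (a :* y :+ z) := a :* (b :* x :+ y) :+ (c :* x :+ z)) refl a b c x y z)
    (⊕-⊛-regroup a b c xs ys zs)

  combination-linear : ∀ a (w w′ : Vec ℝ m) (ps : Vec (Point N) m) →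
    combination (a ⊛ w ⊕ w′) ps ≡ a ⊛ combination w ps ⊕ combination w′ ps
  combination-linear a [] [] [] = sym (trans (cong (_⊕ origin) (⊛-origin a)) (⊕-identityˡ origin))
  combination-linear a (b ∷ w) (c ∷ w′) (p ∷ ps) =
    trans (cong ((a * b + c) ⊛ p ⊕_) (combination-linear a w w′ ps)) (⊕-⊛-regroup a b c p _ _)

  sum-linear : ∀ a (w w′ : Vec ℝ m) → sum (a ⊛ w ⊕ w′) ≡ a * sum w + sum w′
  sum-linear a [] [] = sym (trans (+-identityʳ _) (zeroʳ a))
  sum-linear a (b ∷ w) (c ∷ w′) = trans (cong (a * b + c +_) (sum-linear a w w′))
    (solve 5 (λ a b c s t → a :* b :+ c :+ (a :* s :+ t) := a :* (b :+ s) :+ (c :+ t)) refl a b c (sum w) (sum w′))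

  combination-origin : (ps : Vec (Point N) m) → combination origin ps ≡ origin
  combination-origin [] = refl
  combination-origin (p ∷ ps) = trans (cong₂ _⊕_ (0-⊛ p) (combination-origin ps)) (⊕-identityˡ origin)

  sum-origin : ∀ m → sum (origin {m}) ≡ 0#
  sum-origin zero = refl
  sum-origin (suc m) = trans (+-identityˡ _) (sum-origin m)

  combination-⊛ : ∀ a (w : Vec ℝ m) (ps : Vec (Point N) m) → combination (a ⊛ w) ps ≡ a ⊛ combination w ps
  combination-⊛ a w ps = trans (cong (λ v → combination v ps) (sym (⊕-identityʳ (a ⊛ w))))
    (trans (combination-linear a w origin ps) (trans (cong (a ⊛ combination w ps ⊕_) (combination-origin ps)) (⊕-identityʳ _)))

  sum-⊛ : ∀ a (w : Vec ℝ m) → sum (a ⊛ w) ≡ a * sum w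
  sum-⊛ {m} a w = trans (cong sum (sym (⊕-identityʳ (a ⊛ w)))) (trans (sum-linear a w origin) (trans (cong (a * sum w +_) (sum-origin m)) (+-identityʳ _)))

  -- Merges the weight sum and the combination into one vector, so that `linear-dependence` yields
  -- affine relations.
  combination-homogeneous : (w : Vec ℝ m) (ps : Vec (Point N) m) → combination w (map (1# ∷_) ps) ≡ sum w ∷ combination w ps
  combination-homogeneous [] [] = refl
  combination-homogeneous (a ∷ w) (p ∷ ps) = trans (cong ((a ⊛ (1# ∷ p)) ⊕_) (combination-homogeneous w ps)) (cong (λ b → b + sum w ∷ a ⊛ p ⊕ combination w ps) (*-identityʳ a))

  -- Dimension

  -- Independence of `qs` excludes `w₀ = 0#`, so the relation can be solved for `x`.
  relation⇒aff : (qs : Vec (Point N) m) → AffinelyIndependent qs → ∀ x w₀ w → w₀ ∷ w ≢ origin →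
    w₀ + sum w ≡ 0# → w₀ ⊛ x ⊕ combination w qs ≡ origin → x ∈ₚ aff qs
  relation⇒aff qs independent x w₀ w w≢0 Σ≡0 comb≡0 with w₀ ≟ 0#
  ... | yes refl = contradiction (cong (0# ∷_) (independent w (trans (sym (+-identityˡ _)) Σ≡0)
    (trans (sym (trans (cong (_⊕ combination w qs) (0-⊛ x)) (⊕-identityˡ _))) comb≡0))) w≢0
  ... | no w₀≢0 = let h , w₀h≡1 = inverse w₀ w₀≢0 in
    (- h) ⊛ w ,
    trans (sum-⊛ (- h) w) (trans (trans (solve 3 (λ h w s → :- h :* s := w :* h :- h :* (w :+ s)) refl h w₀ (sum w))
      (cong₂ (λ a b → a − h * b) w₀h≡1 Σ≡0)) (solve 1 (λ h → con (ℤ.+ 1) :- h :* con (ℤ.+ 0) := con (ℤ.+ 1)) refl h)) ,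
    trans (combination-⊛ (- h) w qs) (solve-for h w₀h≡1 x (combination w qs) comb≡0)
    where
    solve-for : ∀ h → w₀ * h ≡ 1# → (x y : Point k) → w₀ ⊛ x ⊕ y ≡ origin → (- h) ⊛ y ≡ x
    solve-for h w₀h≡1 [] [] eq = refl
    solve-for h w₀h≡1 (a ∷ x) (b ∷ y) eq = cong₂ _∷_
      (trans (solve 4 (λ h w a b → :- h :* b := (w :* h) :* a :- h :* (w :* a :+ b)) refl h w₀ a b)
        (trans (cong₂ (λ s t → s * a − h * t) w₀h≡1 (cong head eq)) (solve 2 (λ a h → con (ℤ.+ 1) :* a :- h :* con (ℤ.+ 0) := a) refl a h)))
      (solve-for h w₀h≡1 x y (cong tail eq))

  affine-basis-spans : (qs : Vec (Point d) (suc d)) → AffinelyIndependent qs → ∀ x → x ∈ₚ aff qs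
  affine-basis-spans {d} qs independent x with linear-dependence (ℕ.n<1+n (suc d)) ((1# ∷ x) ∷ map (1# ∷_) qs)
  ... | w₀ ∷ w , w≢0 , eq = relation⇒aff qs independent x w₀ w w≢0 (cong head eq′) (cong tail eq′)
    where
    eq′ : w₀ + sum w ∷ w₀ ⊛ x ⊕ combination w qs ≡ origin
    eq′ = trans (sym (trans (cong ((w₀ ⊛ (1# ∷ x)) ⊕_) (combination-homogeneous w qs)) (cong (λ a → a + sum w ∷ w₀ ⊛ x ⊕ combination w qs) (*-identityʳ w₀)))) eq

  -- The homogenised `z`, `x` and `qs` are `d + 2` vectors of length `d + 1`, hence dependent.
  -- Applying `f` removes `z`, the only one at which `f` is nonzero.
  hyperplane-basis-spans : (qs : Vec (Point d) d) → AffinelyIndependent qs → (f : Vec ℝ (suc d)) → All (λ q → f at q ≡ 0#) qs →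
    ∀ z → f at z ≢ 0# → ∀ x → f at x ≡ 0# → x ∈ₚ aff qs
  hyperplane-basis-spans {d} qs independent f f-qs z fz≢0 x fx≡0
    with linear-dependence (ℕ.n<1+n (suc d)) ((1# ∷ z) ∷ (1# ∷ x) ∷ map (1# ∷_) qs)
  ... | a ∷ w₀ ∷ w , w≢0 , eq = relation⇒aff qs independent x w₀ w (w≢0 ∘ cong₂ _∷_ a≡0) (cong head eq″) (cong tail eq″)
    where
    values : ∀ {n} (w : Vec ℝ n) {qs : Vec (Point d) n} → All (λ q → f at q ≡ 0#) qs → w ∙ map (f ∙_) (map (1# ∷_) qs) ≡ 0#
    values [] [] = refl
    values (b ∷ w) (e ∷ es) = trans (cong₂ _+_ (trans (cong (b *_) e) (zeroʳ b)) (values w es)) (+-identityˡ 0#)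
    a≡0 : a ≡ 0#
    a≡0 = *-cancel-0 (begin
      a * (f at z)                                                ≡⟨ +-identityʳ _ ⟨
      a * (f at z) + 0#                                           ≡⟨ cong (a * (f at z) +_) (trans (cong₂ _+_ (trans (cong (w₀ *_) fx≡0) (zeroʳ w₀)) (values w f-qs)) (+-identityˡ 0#)) ⟨
      a * (f at z) + (w₀ * (f at x) + w ∙ map (f ∙_) (map (1# ∷_) qs)) ≡⟨ ∙-combination f (a ∷ w₀ ∷ w) _ ⟨
      f ∙ combination (a ∷ w₀ ∷ w) ((1# ∷ z) ∷ (1# ∷ x) ∷ map (1# ∷_) qs) ≡⟨ cong (f ∙_) eq ⟩
      f ∙ origin                                                  ≡⟨ ∙-origin f ⟩
      0#                                                          ∎) fz≢0
      where open ≡-Reasoning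
    eq′ : (w₀ ⊛ (1# ∷ x)) ⊕ combination w (map (1# ∷_) qs) ≡ origin
    eq′ = trans (sym (trans (cong (_⊕ ((w₀ ⊛ (1# ∷ x)) ⊕ combination w (map (1# ∷_) qs))) (trans (cong (_⊛ (1# ∷ z)) a≡0) (0-⊛ (1# ∷ z)))) (⊕-identityˡ _))) eq
    eq″ : w₀ + sum w ∷ w₀ ⊛ x ⊕ combination w qs ≡ origin
    eq″ = trans (sym (trans (cong ((w₀ ⊛ (1# ∷ x)) ⊕_) (combination-homogeneous w qs)) (cong (λ a → a + sum w ∷ w₀ ⊛ x ⊕ combination w qs) (*-identityʳ w₀)))) eq′

  -- The `k + 1` coordinate rows of length `k` are linearly dependent. Each row sums to `1#`, so the
  -- dependence is an affine relation between the `ys`.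
  dimension-bound : (ys : Vec (Point N) (suc k)) (qs : Vec (Point N) k) → AffinelyIndependent ys → ¬ All (aff qs) ys
  dimension-bound {k = k} ys qs independent ys⊆aff =
    let Ws , relations = coordinates ys⊆aff
        c , c≢0 , eq = linear-dependence ℕ.≤-refl Ws
        sums , combs = relations c
    in c≢0 (independent c (trans (sym sums) (trans (cong sum eq) (sum-origin k)))
         (trans (sym combs) (trans (cong (λ w → combination w qs) eq) (combination-origin qs))))
    where
    coordinates : ∀ {n} {ys : Vec (Point _) n} → All (aff qs) ys →
      Σ[ Ws ∈ Vec (Vec ℝ k) n ] (∀ c → sum (combination c Ws) ≡ sum c × combination (combination c Ws) qs ≡ combination c ys)
    coordinates [] = [] , λ { [] → sum-origin k , combination-origin qs }
    coordinates ((W , ΣW≡1 , comb) ∷ ys⊆aff) = let Ws , relations = coordinates ys⊆aff in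
      W ∷ Ws , λ { (a ∷ c) → let sums , combs = relations c in
        trans (sum-linear a W (combination c Ws)) (cong₂ _+_ (trans (cong (a *_) ΣW≡1) (*-identityʳ a)) sums) ,
        trans (combination-linear a W (combination c Ws) qs) (cong₂ _⊕_ (cong (a ⊛_) comb) combs) }

  -- Faces

  gap : Point N → ℝ → Vec ℝ (suc N)
  gap c b = b ∷ (- 1#) ⊛ c

  gap-at : ∀ (c : Point N) b x → gap c b at x ≡ b − c ∙ x
  gap-at c b x = cong₂ _+_ (*-identityʳ b) (trans (⊛-∙ (- 1#) c x) (solve 1 (λ s → :- con (ℤ.+ 1) :* s := :- s) refl (c ∙ x)))

  face-by-functional : ∀ {Q F : Subset N} (f : Vec ℝ (suc N)) → (∀ x → x ∈ₚ Q → 0# ≤ f at x) →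
    F ≐ (Q ∩ λ x → f at x ≡ 0#) → IsFace Q F
  face-by-functional (b ∷ c) valid (F⊆ , ⊆F) =
    (- 1#) ⊛ c , b ,
    (λ x x∈Q → 0≤y−x⇒x≤y (subst (0# ≤_) (value x) (valid x x∈Q))) ,
    (λ {x} x∈F → let x∈Q , fx≡0 = F⊆ x∈F in x∈Q , sym (Field.x∙y⁻¹≈ε⇒x≈y _ _ (trans (sym (value x)) fx≡0))) ,
    (λ {x} (x∈Q , cx≡b) → ⊆F (x∈Q , trans (value x) (trans (cong (b −_) cx≡b) (-‿inverseʳ b))))
    where
    value : ∀ x → (b ∷ c) at x ≡ b − ((- 1#) ⊛ c) ∙ x
    value x = trans (cong₂ _+_ (*-identityʳ b) (solve 1 (λ s → s := :- (:- con (ℤ.+ 1) :* s)) refl (c ∙ x))) (cong (λ s → b − s) (sym (⊛-∙ (- 1#) c x)))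

  functional-of-face : ∀ {Q F : Subset N} → IsFace Q F →
    Σ[ f ∈ Vec ℝ (suc N) ] (∀ x → x ∈ₚ Q → 0# ≤ f at x) × F ≐ (Q ∩ λ x → f at x ≡ 0#)
  functional-of-face (c , b , valid , F⊆ , ⊆F) =
    gap c b ,
    (λ x x∈Q → subst (0# ≤_) (sym (gap-at c b x)) (x≤y⇒0≤y−x (valid x x∈Q))) ,
    (λ {x} x∈F → let x∈Q , cx≡b = F⊆ x∈F in x∈Q , trans (gap-at c b x) (trans (cong (b −_) cx≡b) (-‿inverseʳ b))) ,
    (λ {x} (x∈Q , fx≡0) → ⊆F (x∈Q , sym (Field.x∙y⁻¹≈ε⇒x≈y _ _ (trans (sym (gap-at c b x)) fx≡0))))

  at-convex : ∀ (f : Vec ℝ (suc N)) (w : Vec ℝ m) ps {x} → sum w ≡ 1# → combination w ps ≡ x → w ∙ map (f at_) ps ≡ f at x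
  at-convex (b ∷ c) w ps Σw≡1 refl = trans (at-combination b c w ps) (cong (λ s → b * s + c ∙ combination w ps) Σw≡1)

  ∙-nonneg : (w v : Vec ℝ m) → (∀ i → 0# ≤ lookup w i * lookup v i) → 0# ≤ w ∙ v
  ∙-nonneg [] [] _ = inj₂ refl
  ∙-nonneg (a ∷ w) (b ∷ v) nonneg = +-nonneg (nonneg zero) (∙-nonneg w v (nonneg ∘ suc))

  ∙-zero-terms : (w v : Vec ℝ m) → (∀ i → 0# ≤ lookup w i * lookup v i) → w ∙ v ≡ 0# → ∀ i → lookup w i * lookup v i ≡ 0#
  ∙-zero-terms (a ∷ w) (b ∷ v) nonneg eq i with nonneg zero
  ... | inj₁ 0<ab = contradiction (trans (+-comm _ _) eq) (0<⇒≢0 (0≤-+-0< (∙-nonneg w v (nonneg ∘ suc)) 0<ab))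
  ∙-zero-terms (a ∷ w) (b ∷ v) nonneg eq zero | inj₂ 0≡ab = sym 0≡ab
  ∙-zero-terms (a ∷ w) (b ∷ v) nonneg eq (suc i) | inj₂ 0≡ab =
    ∙-zero-terms w v (nonneg ∘ suc) (trans (sym (trans (cong (_+ w ∙ v) (sym 0≡ab)) (+-identityˡ _))) eq) i

  unit : Fin m → Vec ℝ m
  unit zero = 1# ∷ origin
  unit (suc i) = 0# ∷ unit i

  unit-nonneg : (i : Fin m) → All (0# ≤_) (unit i)
  unit-nonneg zero = inj₁ 0<1 ∷ origin-nonneg _
    where
    origin-nonneg : ∀ m → All (0# ≤_) (origin {m})
    origin-nonneg zero = []
    origin-nonneg (suc m) = inj₂ refl ∷ origin-nonneg m
  unit-nonneg (suc i) = inj₂ refl ∷ unit-nonneg i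

  sum-unit : (i : Fin m) → sum (unit i) ≡ 1#
  sum-unit {suc m} zero = trans (cong (1# +_) (sum-origin m)) (+-identityʳ 1#)
  sum-unit (suc i) = trans (+-identityˡ _) (sum-unit i)

  combination-unit : (i : Fin m) (ps : Vec (Point N) m) → combination (unit i) ps ≡ lookup ps i
  combination-unit zero (p ∷ ps) = trans (cong₂ _⊕_ (1-⊛ p) (combination-origin ps)) (⊕-identityʳ p)
  combination-unit (suc i) (p ∷ ps) = trans (cong₂ _⊕_ (0-⊛ p) (combination-unit i ps)) (⊕-identityˡ _)

  weights-unit : (w : Vec ℝ m) (i : Fin m) → sum w ≡ 1# → (∀ j → j ≢ i → lookup w j ≡ 0#) → w ≡ unit i
  weights-unit {suc m} (a ∷ w) zero Σw≡1 zeros = cong₂ _∷_ a≡1 w≡0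
    where
    w≡0 : w ≡ origin
    w≡0 = lookup-ext λ j → trans (zeros (suc j) λ ()) (sym (lookup-replicate j 0#))
    a≡1 : a ≡ 1#
    a≡1 = trans (sym (trans (cong (a +_) (trans (cong sum w≡0) (sum-origin m))) (+-identityʳ a))) Σw≡1
  weights-unit (a ∷ w) (suc i) Σw≡1 zeros = cong₂ _∷_ (zeros zero λ ())
    (weights-unit w i (trans (sym (trans (cong (_+ sum w) (zeros zero λ ())) (+-identityˡ _))) Σw≡1) (λ j j≢i → zeros (suc j) (j≢i ∘ Fin.suc-injective)))

  nonzero-weight : (w : Vec ℝ m) → sum w ≢ 0# → Σ[ i ∈ Fin m ] lookup w i ≢ 0#
  nonzero-weight [] ≢0 = contradiction refl ≢0
  nonzero-weight (a ∷ w) ≢0 with a ≟ 0#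
  ... | no a≢0 = zero , a≢0
  ... | yes refl = let i , wi≢0 = nonzero-weight w (λ eq → ≢0 (trans (+-identityˡ _) eq)) in suc i , wi≢0

  -- Weights supported on a subset

  embed : (S : Vec Bool m) → Vec ℝ (count S) → Vec ℝ m
  embed [] [] = []
  embed (true ∷ S) (a ∷ w) = a ∷ embed S w
  embed (false ∷ S) w = 0# ∷ embed S w

  embed-supported : ∀ (S : Vec Bool m) w → Supported (embed S w) S
  embed-supported (true ∷ S) (a ∷ w) (suc i) eq = embed-supported S w i eq
  embed-supported (false ∷ S) w zero eq = refl
  embed-supported (false ∷ S) w (suc i) eq = embed-supported S w i eq

  sum-embed : ∀ (S : Vec Bool m) w → sum (embed S w) ≡ sum w
  sum-embed [] [] = refl
  sum-embed (true ∷ S) (a ∷ w) = cong (a +_) (sum-embed S w)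
  sum-embed (false ∷ S) w = trans (+-identityˡ _) (sum-embed S w)

  combination-embed : ∀ (S : Vec Bool m) w (ps : Vec (Point N) m) → combination (embed S w) ps ≡ combination w (select S ps)
  combination-embed [] [] [] = refl
  combination-embed (true ∷ S) (a ∷ w) (p ∷ ps) = cong (a ⊛ p ⊕_) (combination-embed S w ps)
  combination-embed (false ∷ S) w (p ∷ ps) = trans (cong₂ _⊕_ (0-⊛ p) (combination-embed S w ps)) (⊕-identityˡ _)

  embed-nonneg : ∀ (S : Vec Bool m) {w} → All (0# ≤_) w → All (0# ≤_) (embed S w)
  embed-nonneg [] [] = []
  embed-nonneg (true ∷ S) (a ∷ w) = a ∷ embed-nonneg S w
  embed-nonneg (false ∷ S) w = inj₂ refl ∷ embed-nonneg S w

  embed-origin : ∀ (S : Vec Bool m) w → embed S w ≡ origin → w ≡ origin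
  embed-origin [] [] eq = refl
  embed-origin (true ∷ S) (a ∷ w) eq = cong₂ _∷_ (cong head eq) (embed-origin S w (cong tail eq))
  embed-origin (false ∷ S) w eq = embed-origin S w (cong tail eq)

  embed-select : ∀ (S : Vec Bool m) w → Supported w S → embed S (select S w) ≡ w
  embed-select [] [] _ = refl
  embed-select (true ∷ S) (a ∷ w) supported = cong (a ∷_) (embed-select S w (supported ∘ suc))
  embed-select (false ∷ S) (a ∷ w) supported = cong₂ _∷_ (sym (supported zero refl)) (embed-select S w (supported ∘ suc))

  select-All : ∀ {P : X → Set} (S : Vec Bool m) {xs} → All P xs → All P (select S xs)
  select-All [] [] = []
  select-All (true ∷ S) (x ∷ xs) = x ∷ select-All S xs
  select-All (false ∷ S) (x ∷ xs) = select-All S xs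

  select-members : ∀ {P : X → Set} (S : Vec Bool m) (xs : Vec X m) → (∀ i → lookup S i ≡ true → P (lookup xs i)) → All P (select S xs)
  select-members [] [] _ = []
  select-members (true ∷ S) (x ∷ xs) ps = ps zero refl ∷ select-members S xs (ps ∘ suc)
  select-members (false ∷ S) (x ∷ xs) ps = select-members S xs (ps ∘ suc)

  independent-select : ∀ (p : Fin m → Point d) S → Independent p S → AffinelyIndependent (select S (tabulate p))
  independent-select p S independent w Σw≡0 comb≡0 = embed-origin S w
    (independent (embed S w) (embed-supported S w) (trans (sum-embed S w) Σw≡0) (trans (combination-embed S w (tabulate p)) comb≡0))

  shrink : ∀ k (S : Vec Bool m) → k ℕ.≤ count S → Σ[ S′ ∈ Vec Bool m ] count S′ ≡ k × (∀ i → lookup S′ i ≡ true → lookup S i ≡ true)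
  shrink zero [] _ = [] , refl , λ ()
  shrink k (false ∷ S) k≤ = let S′ , eq , S′⊆S = shrink k S k≤ in
    false ∷ S′ , eq , λ { (suc i) → S′⊆S i }
  shrink zero (true ∷ S) _ = let S′ , eq , S′⊆S = shrink zero S ℕ.z≤n in
    false ∷ S′ , eq , λ { (suc i) → S′⊆S i }
  shrink (suc k) (true ∷ S) (ℕ.s≤s k≤) = let S′ , eq , S′⊆S = shrink k S k≤ in
    true ∷ S′ , cong suc eq , λ { zero _ → refl ; (suc i) → S′⊆S i }

  -- Convex hulls of points in general position

  -- `IsSimplex` demands at least one vertex; the empty list is excluded because its weights cannot
  -- sum to `1#`.
  nonempty-simplex : ∀ {F : Subset N} (qs : Vec (Point N) k) → AffinelyIndependent qs → F ≐ conv qs → Satisfiable F → IsSimplex F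
  nonempty-simplex [] _ (F⊆ , _) (x , x∈F) with F⊆ x∈F
  ... | [] , _ , Σ≡1 , _ = contradiction Σ≡1 0≢1
  nonempty-simplex (q ∷ qs) independent F≐ _ = _ , q ∷ qs , independent , F≐

  module Hull {m d : ℕ} (p : Fin m → Point d) (general : GeneralPosition p) (d<m : d ℕ.< m) where
    ps : Vec (Point d) m
    ps = tabulate p

    Q : Subset d
    Q = conv ps

    p∈Q : ∀ i → p i ∈ₚ Q
    p∈Q i = unit i , unit-nonneg i , sum-unit i , trans (combination-unit i ps) (lookup∘tabulate p i)

    at-hull : ∀ f {x} ((w , _) : x ∈ₚ Q) → w ∙ map (f at_) ps ≡ f at x
    at-hull f (w , _ , Σw≡1 , comb) = at-convex f w ps Σw≡1 comb

    terms-nonneg : ∀ f {x} ((w , _) : x ∈ₚ Q) → (∀ i → lookup w i ≢ 0# → 0# ≤ f at p i) → ∀ i → 0# ≤ lookup w i * lookup (map (f at_) ps) i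
    terms-nonneg f (w , w≥0 , _) nonneg i with lookup w i ≟ 0#
    ... | yes wi≡0 = inj₂ (sym (trans (cong (_* lookup (map (f at_) ps) i) wi≡0) (zeroˡ _)))
    ... | no wi≢0 = *-nonneg (All.lookup⁺ w≥0 i) (subst (0# ≤_) (sym (lookup-map-tabulate (f at_) p i)) (nonneg i wi≢0))

    hull-nonneg : ∀ f → (∀ i → 0# ≤ f at p i) → ∀ x → x ∈ₚ Q → 0# ≤ f at x
    hull-nonneg f nonneg x x∈Q = subst (0# ≤_) (at-hull f x∈Q) (∙-nonneg (proj₁ x∈Q) (map (f at_) ps) (terms-nonneg f x∈Q (λ i _ → nonneg i)))

    -- A vanishing sum of nonnegative terms has only zero terms. Nonnegativity is asked only where
    -- the weight is nonzero, because in `face-vertex` the functional `g` is valid on the face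
    -- alone.
    complementary-slackness : ∀ f {x} ((w , _) : x ∈ₚ Q) → (∀ i → lookup w i ≢ 0# → 0# ≤ f at p i) → f at x ≡ 0# →
      ∀ i → lookup w i ≢ 0# → f at p i ≡ 0#
    complementary-slackness f x∈Q@(w , _) nonneg fx≡0 i wi≢0 = *-cancel-0
      (trans (*-comm _ _) (trans (cong (lookup w i *_) (sym (lookup-map-tabulate (f at_) p i)))
        (∙-zero-terms w (map (f at_) ps) (terms-nonneg f x∈Q nonneg) (trans (at-hull f x∈Q) fx≡0) i)))
      wi≢0

    positive-weight : ∀ {x} ((w , _) : x ∈ₚ Q) → Σ[ i ∈ Fin m ] lookup w i ≢ 0#
    positive-weight (w , _ , Σw≡1 , _) = nonzero-weight w (λ eq → 0≢1 (trans (sym eq) Σw≡1))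

    -- By slackness a point of contact has all its weight at `i`.
    exposed-vertex : ∀ f i → f at p i ≡ 0# → (∀ j → j ≢ i → 0# < f at p j) → p i ∈ₚ V Q
    exposed-vertex f i fi≡0 fj>0 = face-by-functional f (hull-nonneg f nonneg)
      ( (λ { refl → p∈Q i , fi≡0 })
      , (λ { (x∈Q@(w , _ , Σw≡1 , comb) , fx≡0) →
          trans (sym (trans (combination-unit i ps) (lookup∘tabulate p i)))
            (trans (cong (λ w → combination w ps) (sym (weights-unit w i Σw≡1 (others x∈Q fx≡0)))) comb) }) )
      where
      nonneg : ∀ j → 0# ≤ f at p j
      nonneg j with j Fin.≟ i
      ... | yes refl = inj₂ (sym fi≡0)
      ... | no j≢i = inj₁ (fj>0 j j≢i)
      others : ∀ {x} ((w , _) : x ∈ₚ Q) → f at x ≡ 0# → ∀ j → j ≢ i → lookup w j ≡ 0#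
      others x∈Q@(w , _) fx≡0 j j≢i with lookup w j ≟ 0#
      ... | yes wj≡0 = wj≡0
      ... | no wj≢0 = contradiction (complementary-slackness f x∈Q (λ k _ → nonneg k) fx≡0 j wj≢0) (0<⇒≢0 (fj>0 j j≢i))

    -- A point `p i` of nonzero weight in `v` lies on the face and on the zero set of the functional
    -- that isolates `v` there, hence equals `v`.
    face-vertex : ∀ f → (∀ i → 0# ≤ f at p i) → ∀ v → v ∈ₚ V (Q ∩ λ x → f at x ≡ 0#) → Σ[ i ∈ Fin m ] f at p i ≡ 0# × v ≡ p i
    face-vertex f f≥0 v v∈VF =
      let g , g≥0 , v⊆ , ⊆v = functional-of-face v∈VF
          (v∈Q , fv≡0) , gv≡0 = v⊆ refl
          i , wi≢0 = positive-weight v∈Q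
          on-F = complementary-slackness f v∈Q (λ j _ → f≥0 j) fv≡0
          gi≡0 = complementary-slackness g v∈Q (λ j wj≢0 → g≥0 (p j) (p∈Q j , on-F j wj≢0)) gv≡0 i wi≢0
      in i , on-F i wi≢0 , ⊆v ((p∈Q i , on-F i wi≢0) , gi≡0)

    hull-vertex : ∀ v → v ∈ₚ V Q → Σ[ i ∈ Fin m ] v ≡ p i
    hull-vertex v v∈VQ =
      let g , g≥0 , v⊆ , ⊆v = functional-of-face v∈VQ
          v∈Q , gv≡0 = v⊆ refl
          i , wi≢0 = positive-weight v∈Q
      in i , ⊆v (p∈Q i , complementary-slackness g v∈Q (λ j _ → g≥0 (p j) (p∈Q j)) gv≡0 i wi≢0)

    independent-points : ∀ S {k} → k ℕ.≤ count S → k ℕ.≤ suc d →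
      Σ[ qs ∈ Vec (Point d) k ] AffinelyIndependent qs × (∀ {P : Point d → Set} → (∀ i → lookup S i ≡ true → P (p i)) → All P qs)
    independent-points S {k} k≤S k≤1+d with shrink k S k≤S
    ... | S′ , refl , S′⊆S = select S′ ps , independent-select p S′ (general S′ k≤1+d) ,
      λ {P} P-S → select-members S′ ps (λ i S′i → subst P (sym (lookup∘tabulate p i)) (P-S i (S′⊆S i S′i)))

    hull-dimension : HasDimension Q d
    hull-dimension =
      let qs , independent , members = independent-points (replicate m true) (subst (suc d ℕ.≤_) (sym (count-all m)) d<m) ℕ.≤-refl
      in qs , members (λ i _ → p∈Q i) , independent , λ {x} _ → affine-basis-spans qs independent x
      where
      count-all : ∀ m → count (replicate m true) ≡ m
      count-all zero = refl
      count-all (suc m) = cong suc (count-all m)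

    module _ (f : Vec ℝ (suc d)) (f≥0 : ∀ x → x ∈ₚ Q → 0# ≤ f at x) where
      contact : Vec Bool m
      contact = tabulate (λ i → does (f at p i ≟ 0#))

      contact-true : ∀ i → lookup contact i ≡ true → f at p i ≡ 0#
      contact-true i eq with f at p i ≟ 0# | trans (sym (lookup∘tabulate (λ i → does (f at p i ≟ 0#)) i)) eq
      ... | yes fi≡0 | _ = fi≡0

      contact-false : ∀ i → lookup contact i ≡ false → f at p i ≢ 0#
      contact-false i eq with f at p i ≟ 0# | trans (sym (lookup∘tabulate (λ i → does (f at p i ≟ 0#)) i)) eq
      ... | no fi≢0 | _ = fi≢0

      face-is-hull : (Q ∩ λ x → f at x ≡ 0#) ≐ conv (select contact ps)
      face-is-hull = ⊆-hull , hull-⊆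
        where
        ⊆-hull : (Q ∩ λ x → f at x ≡ 0#) ⊆ conv (select contact ps)
        ⊆-hull (x∈Q@(w , w≥0 , Σw≡1 , comb) , fx≡0) =
          select contact w , select-All contact w≥0 ,
          trans (trans (sym (sum-embed contact (select contact w))) (cong sum (embed-select contact w supported))) Σw≡1 ,
          trans (trans (sym (combination-embed contact (select contact w) ps)) (cong (λ w → combination w ps) (embed-select contact w supported))) comb
          where
          supported : Supported w contact
          supported i eq with lookup w i ≟ 0#
          ... | yes wi≡0 = wi≡0
          ... | no wi≢0 = contradiction (complementary-slackness f x∈Q (λ j _ → f≥0 (p j) (p∈Q j)) fx≡0 i wi≢0) (contact-false i eq)
        hull-⊆ : conv (select contact ps) ⊆ (Q ∩ λ x → f at x ≡ 0#)
        hull-⊆ {x} (w , w≥0 , Σw≡1 , comb) = x∈Q , trans (sym (at-hull f x∈Q)) (∙-vanishing (embed contact w) _ terms)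
          where
          x∈Q : x ∈ₚ Q
          x∈Q = embed contact w , embed-nonneg contact w≥0 , trans (sum-embed contact w) Σw≡1 , trans (combination-embed contact w ps) comb
          terms : ∀ i → lookup (embed contact w) i * lookup (map (f at_) ps) i ≡ 0#
          terms i with lookup contact i in eq
          ... | true = trans (cong (lookup (embed contact w) i *_) (trans (lookup-map-tabulate (f at_) p i) (contact-true i eq))) (zeroʳ _)
          ... | false = trans (cong (_* lookup (map (f at_) ps) i) (embed-supported contact w i eq)) (zeroˡ _)

      -- `d + 1` points of contact in general position already span the whole space.
      degenerate-face : suc d ℕ.≤ count contact → ∀ x → f at x ≡ 0#
      degenerate-face 1+d≤ x =
        let qs , independent , members = independent-points contact 1+d≤ ℕ.≤-refl
            w , Σw≡1 , comb = affine-basis-spans qs independent x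
        in trans (sym (at-convex f w qs Σw≡1 comb)) (zeros w (members contact-true))
        where
        zeros : ∀ {n} (w : Vec ℝ n) {qs : Vec (Point d) n} → All (λ q → f at q ≡ 0#) qs → w ∙ map (f at_) qs ≡ 0#
        zeros [] [] = refl
        zeros (b ∷ w) (e ∷ es) = trans (cong₂ _+_ (trans (cong (b *_) e) (zeroʳ b)) (zeros w es)) (+-identityˡ 0#)

    -- With at most `d` points of contact the face is the hull of independent points. With more, its
    -- functional vanishes everywhere, so the face is all of `Q` and has too large a dimension for a
    -- facet.
    hull-simplicial : IsSimplicial Q
    hull-simplicial F (face , k , (ys , ys∈Q , ys-independent , _) , (zs , z∈F ∷ _ , _ , F⊆aff)) = simplex (functional-of-face face)
      where
      simplex : Σ[ f ∈ Vec ℝ (suc d) ] (∀ x → x ∈ₚ Q → 0# ≤ f at x) × F ≐ (Q ∩ λ x → f at x ≡ 0#) → IsSimplex F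
      simplex (f , f≥0 , F⊆ , ⊆F) with count (contact f f≥0) ℕ.≤? d
      ... | yes small = nonempty-simplex (select (contact f f≥0) ps)
        (independent-select p (contact f f≥0) (general (contact f f≥0) (ℕ.m≤n⇒m≤1+n small)))
        ((λ x∈F → proj₁ (face-is-hull f f≥0) (F⊆ x∈F)) , (λ x∈conv → ⊆F (proj₂ (face-is-hull f f≥0) x∈conv)))
        (_ , z∈F)
      ... | no large = contradiction
        (All.map (λ {y} y∈Q → F⊆aff (⊆F (y∈Q , degenerate-face f f≥0 (ℕ.≰⇒> large) y))) ys∈Q)
        (dimension-bound ys zs ys-independent)

  -- Facets and vertices of the hull from certificates

  module FacetOfHull {m d : ℕ} (p : Fin m → Point (suc d)) (general : GeneralPosition p) (d<m : suc d ℕ.< m)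
                     {l : Fin (suc d) → Fin m} (facet : SimplexFacet p l) where
    open Hull p general d<m
    open SimplexFacet facet

    Facet : Subset (suc d)
    Facet = Q ∩ λ x → support at x ≡ 0#

    on-or-off : ∀ i → (Σ[ k ∈ Fin (suc d) ] i ≡ l k) ⊎ 0# < support at p i
    on-or-off i with Fin.any? (λ k → i Fin.≟ l k)
    ... | yes on = inj₁ on
    ... | no off = inj₂ (support-off i (λ k eq → off (k , eq)))

    support-nonneg : ∀ i → 0# ≤ support at p i
    support-nonneg i with on-or-off i
    ... | inj₁ (k , refl) = inj₂ (sym (support-on k))
    ... | inj₂ 0<s = inj₁ 0<s

    vertices : Vec (Point (suc d)) (suc d)
    vertices = tabulate (p ∘ l)

    vertices-all : ∀ {P : Point (suc d) → Set} → (∀ k → P (p (l k))) → All P vertices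
    vertices-all {P} P-l = All.lookup⁻ (λ k → subst P (sym (lookup∘tabulate (p ∘ l) k)) (P-l k))

    -- Applying `dual k` to an affine relation leaves only the term of weight `k`.
    vertices-independent : AffinelyIndependent vertices
    vertices-independent w Σw≡0 comb≡0 = lookup-ext λ k → trans (weight k) (sym (lookup-replicate k 0#))
      where
      weight : ∀ k → lookup w k ≡ 0#
      weight k = *-cancel-0
        (trans (cong (lookup w k *_) (sym (lookup-map-tabulate (dual k at_) (p ∘ l) k)))
          (trans (sym (∙-single w (map (dual k at_) vertices) k λ k′ k′≢k →
              trans (cong (lookup w k′ *_) (trans (lookup-map-tabulate (dual k at_) (p ∘ l) k′) (dual-off k′≢k))) (zeroʳ _)))
            (at-affine-relation (dual k) w vertices Σw≡0 comb≡0)))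
        (0<⇒≢0 (dual-on k))

    -- By pigeonhole `l` misses an index. The point found keeps the support hyperplane proper, as
    -- `hyperplane-basis-spans` requires.
    outside : Σ[ i ∈ Fin m ] 0# < support at p i
    outside with Fin.any? (λ i → ¬? (Fin.any? (λ k → i Fin.≟ l k)))
    ... | yes (i , off) = i , support-off i (λ k eq → off (k , eq))
    ... | no ¬off = contradiction (Fin.pigeonhole d<m index) λ { (i , j , i<j , eq) →
        Fin.<⇒≢ i<j (trans (proj₂ (covered i)) (trans (cong l eq) (sym (proj₂ (covered j))))) }
      where
      covered : ∀ i → Σ[ k ∈ Fin (suc d) ] i ≡ l k
      covered i with Fin.any? (λ k → i Fin.≟ l k)
      ... | yes on = on
      ... | no off = contradiction (i , off) ¬off
      index : Fin m → Fin (suc d)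
      index i = proj₁ (covered i)

    isFacet : IsFacet Q Facet
    isFacet = face-by-functional support (hull-nonneg support support-nonneg) ((λ x∈F → x∈F) , (λ x∈F → x∈F)) ,
      d , hull-dimension ,
      vertices , vertices-all (λ k → p∈Q (l k) , support-on k) , vertices-independent ,
      λ {x} (_ , sx≡0) → let i , 0<si = outside in
        hyperplane-basis-spans vertices vertices-independent support (vertices-all support-on) (p i) (0<⇒≢0 0<si) x sx≡0

    facet-vertex : ∀ v → v ∈ₚ V Facet → Σ[ k ∈ Fin (suc d) ] v ≡ p (l k)
    facet-vertex v v∈VF with face-vertex support support-nonneg v v∈VF
    ... | i , si≡0 , v≡pi with on-or-off i
    ... | inj₁ (k , refl) = k , v≡pi
    ... | inj₂ 0<si = contradiction si≡0 (0<⇒≢0 0<si)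

    module _ (l-inj : ∀ {k k′} → l k ≡ l k′ → k ≡ k′) (k₀ : Fin (suc d)) where
      private
        a = dual k₀ at p (l k₀)

        -- Zero at `p (l k₀)` and equal to the positive `a` at the other vertices of the facet, so
        -- that adding a small multiple to `support` leaves a single zero among the points.
        tilt : Vec ℝ (2 ℕ.+ d)
        tilt = 1# ⊛ (a ∷ origin) ⊕ (- 1#) ⊛ dual k₀

        tilt-at : ∀ x → tilt at x ≡ a − dual k₀ at x
        tilt-at x = trans (⊕-at 1# (- 1#) (a ∷ origin) (dual k₀) x)
          (trans (cong (λ z → 1# * (a * 1# + z) + - 1# * (dual k₀ at x)) (origin-∙ x))
            (solve 2 (λ a s → con (ℤ.+ 1) :* (a :* con (ℤ.+ 1) :+ con (ℤ.+ 0)) :+ :- con (ℤ.+ 1) :* s := a :- s) refl a (dual k₀ at x)))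

        tilted : ℝ → Vec ℝ (2 ℕ.+ d)
        tilted t = 1# ⊛ support ⊕ t ⊛ tilt

        tilted-at : ∀ t x → tilted t at x ≡ support at x + t * (a − dual k₀ at x)
        tilted-at t x = trans (⊕-at 1# t support tilt x) (cong₂ _+_ (*-identityˡ _) (cong (t *_) (tilt-at x)))

      -- Tilting the supporting hyperplane of the facet about all vertices but one exposes that one.
      exposing-functional : Σ[ f ∈ Vec ℝ (2 ℕ.+ d) ] f at p (l k₀) ≡ 0# × (∀ j → j ≢ l k₀ → 0# < f at p j)
      exposing-functional =
        let t , 0<t , positive = small-witness (uniform-Fin {P = λ j t → j ≢ l k₀ → 0# < tilted t at p j} small-positive)
        in tilted t , trans (tilted-at t (p (l k₀)))
             (trans (cong₂ _+_ (support-on k₀) (trans (cong (t *_) (-‿inverseʳ a)) (zeroʳ t))) (+-identityˡ 0#)) , positive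
        where
        small-positive : ∀ j → Small (λ t → j ≢ l k₀ → 0# < tilted t at p j)
        small-positive j with on-or-off j
        ... | inj₂ 0<sj = small-map
          (λ t _ pos _ → subst (0# <_) (trans
            (solve 4 (λ s t a r → s :- t :* (r :- a) := s :+ t :* (a :- r)) refl (support at p j) t a (dual k₀ at p j)) (sym (tilted-at t (p j)))) pos)
          (small-linear ((dual k₀ at p j) − a) 0<sj)
        ... | inj₁ (k , refl) = small-const λ t 0<t j≢ → subst (0# <_)
          (sym (trans (tilted-at t (p (l k))) (trans (cong₂ (λ s r → s + t * (a − r)) (support-on k) (dual-off (j≢ ∘ cong l)))
            (solve 2 (λ t a → con (ℤ.+ 0) :+ t :* (a :- con (ℤ.+ 0)) := t :* a) refl t a))))
          (*-pos 0<t (dual-on k₀))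

      facet-vertex-in-hull : p (l k₀) ∈ₚ V Q
      facet-vertex-in-hull = let f , on , off = exposing-functional in exposed-vertex f (l k₀) on off

      p-injective-at : ∀ j → p (l k₀) ≡ p j → l k₀ ≡ j
      p-injective-at j eq with j Fin.≟ l k₀
      ... | yes j≡ = sym j≡
      ... | no j≢ = let f , on , off = exposing-functional in
        contradiction (trans (cong (f at_) (sym eq)) on) (0<⇒≢0 (off j j≢))

      vertex-of-facet : p (l k₀) ∈ₚ V Facet
      vertex-of-facet =
        let f , f≥0 , v⊆ , ⊆v = functional-of-face facet-vertex-in-hull in
        face-by-functional f (λ x (x∈Q , _) → f≥0 x x∈Q)
          ((λ { refl → (p∈Q (l k₀) , support-on k₀) , proj₂ (v⊆ refl) }) , (λ { ((x∈Q , _) , fx≡0) → ⊆v (x∈Q , fx≡0) }))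

  -- Words

  encode : ∀ {d n} → Word d n → Fin (d ℕ.^ n)
  encode [] = zero
  encode (k ∷ x) = combine k (encode x)

  decode : ∀ {d} n → Fin (d ℕ.^ n) → Word d n
  decode zero i = []
  decode {d} (suc n) i = let k , j = remQuot {d} (d ℕ.^ n) i in k ∷ decode n j

  decode-encode : ∀ {d n} (x : Word d n) → decode n (encode x) ≡ x
  decode-encode [] = refl
  decode-encode {d} {suc n} (k ∷ x) = cong₂ _∷_ (cong proj₁ eq) (trans (cong (decode n ∘ proj₂) eq) (decode-encode x))
    where eq = Fin.remQuot-combine {d} {d ℕ.^ n} k (encode x)

  encode-decode : ∀ {d} n (i : Fin (d ℕ.^ n)) → encode (decode n i) ≡ i
  encode-decode zero zero = refl
  encode-decode {d} (suc n) i = let k , j = remQuot {d} (d ℕ.^ n) i in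
    trans (cong (combine {d} k) (encode-decode n j)) (Fin.combine-remQuot {d} (d ℕ.^ n) i)

  module _ {d n : ℕ} where
    encode-injective : {x y : Word d n} → encode x ≡ encode y → x ≡ y
    encode-injective {x} {y} eq = trans (sym (decode-encode x)) (trans (cong (decode n) eq) (decode-encode y))

  line-injective : ∀ {d n} {τ : Vec (Maybe (Fin d)) n} → nothing ∈ᵛ τ → ∀ {k k′} → map (fromMaybe k) τ ≡ map (fromMaybe k′) τ → k ≡ k′
  line-injective {τ = nothing ∷ τ} (here refl) eq = cong head eq
  line-injective {τ = _ ∷ τ} (there star) eq = line-injective star (cong tail eq)

  -- Puts every word on a facet, so that being a vertex and being distinct from the other points
  -- need proof only for vertices of certified facets.
  line-through : ∀ {d n} → 1 ℕ.≤ n → (x : Word d n) → Σ[ τ ∈ Template d n ] Σ[ k ∈ Fin d ] σ τ k ≡ x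
  line-through (ℕ.s≤s _) (k ∷ x) = (nothing ∷ map just x , here refl) , k , cong (k ∷_) (fill x)
    where
    fill : ∀ {n} (x : Word _ n) → map (fromMaybe k) (map just x) ≡ x
    fill [] = refl
    fill (j ∷ x) = cong (j ∷_) (fill x)

  -- Assembly of the polytope and the bijection

  module Construction (e n : ℕ) (2≤n : 2 ℕ.≤ n) where
    D M : ℕ
    D = 5 ℕ.+ e
    M = D ℕ.^ n

    line : Vec (Maybe (Fin D)) n → Fin D → Fin M
    line τ k = encode (map (fromMaybe k) τ)

    perturbed : Σ[ p ∈ (Fin M → Point D) ] (∀ τ → nothing ∈ᵛ τ → SimplexFacet p (line τ)) × GeneralPosition p
    perturbed =
      let p , facets = initial-configuration e n (decode n) encode decode-encode (encode-decode n) in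
      perturb-to-general-position (uniform-Vec (uniform-Maybe uniform-Fin)) line
        (λ τ → Any.any? (λ a → Maybe.≡-dec Fin._≟_ nothing a) τ)
        (λ τ star eq → line-injective star (encode-injective eq)) p facets

    -- A `D`-dimensional polytope has more than `D` vertices, whereas there are only `D` words of
    -- length one; hence `2 ≤ n`.
    D<M : D ℕ.< M
    D<M = subst (ℕ._< M) (ℕ.*-identityʳ D) (ℕ.^-monoʳ-< D (ℕ.s≤s (ℕ.s≤s ℕ.z≤n)) {1} {n} 2≤n)

    p : Fin M → Point D
    p = proj₁ perturbed

    facets : ∀ τ → nothing ∈ᵛ τ → SimplexFacet p (line τ)
    facets = proj₁ (proj₂ perturbed)

    general : GeneralPosition p
    general = proj₂ (proj₂ perturbed)

    open Hull p general D<M using (Q; hull-vertex; hull-dimension; hull-simplicial)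

    module At (τ : Template D n) = FacetOfHull p general D<M (facets (proj₁ τ) (proj₂ τ))

    line-inj : (τ : Template D n) → ∀ {k k′} → line (proj₁ τ) k ≡ line (proj₁ τ) k′ → k ≡ k′
    line-inj (_ , star) eq = line-injective star (encode-injective eq)

    vertex : ∀ x → p (encode x) ∈ₚ V Q
    vertex x = let τ , k , eq = line-through (ℕ.<⇒≤ 2≤n) x in
      subst (λ x → p (encode x) ∈ₚ V Q) eq (At.facet-vertex-in-hull τ (line-inj τ) k)

    p-injective : ∀ {x y} → p (encode x) ≡ p (encode y) → x ≡ y
    p-injective {x} {y} eq = let τ , k , σ≡x = line-through (ℕ.<⇒≤ 2≤n) x in
      trans (sym σ≡x) (encode-injective (At.p-injective-at τ (line-inj τ) k (encode y) (trans (cong (p ∘ encode) σ≡x) eq)))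

    φ : Bijection (setoid (Word D n)) (Vertex Q)
    φ = record
      { to = λ x → p (encode x) , vertex x
      ; cong = λ { refl → refl }
      ; bijective = p-injective , λ (v , v∈VQ) → let i , v≡pi = hull-vertex v v∈VQ in
          decode n i , λ { refl → trans (cong p (encode-decode n i)) (sym v≡pi) }
      }

    theorem : ∃[ N ] Σ[ Q ∈ Subset N ]
      IsPolytope Q × HasDimension Q D × IsSimplicial Q ×
      (Σ[ φ ∈ Bijection (setoid (Word D n)) (Vertex Q) ]
      ((L : Pred (Word D n) 0ℓ) → Hypergraph.Hyperedge (HJ D n) L →
      Σ[ F ∈ Subset N ] IsFacet Q F × image (proj₁ ∘ Bijection.to φ) L ≐ V F))
    theorem = D , Q , (M , tabulate p , (λ x → x) , (λ x → x)) , hull-dimension , hull-simplicial , φ ,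
      λ L (τ , L⊆ , ⊆L) → At.Facet τ , At.isFacet τ ,
        (λ { (x , x∈L , refl) → let k , x≡σ = L⊆ x∈L in
             subst (λ x → p (encode x) ∈ₚ V (At.Facet τ)) (sym x≡σ) (At.vertex-of-facet τ (line-inj τ) k) }) ,
        (λ {v} v∈VF → let k , v≡ = At.facet-vertex τ v v∈VF in
             σ τ k , ⊆L (k , refl) , sym v≡)

open import Data.Nat.Base using (_≤_)

theorem2p2 : (R : RealNumbers) → let open Polytopes R in
    (d n : ℕ) → 5 ≤ d → 2 ≤ n →
    ∃[ N ] Σ[ Q ∈ Subset N ]
    IsPolytope Q × HasDimension Q d × IsSimplicial Q ×
    (Σ[ φ ∈ Bijection (setoid (Word d n)) (Vertex Q) ]
    ((L : Pred (Word d n) 0ℓ) → Hypergraph.Hyperedge (HJ d n) L →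
    Σ[ F ∈ Subset N ] IsFacet Q F × image (proj₁ ∘ Bijection.to φ) L ≐ V F))
theorem2p2 R _ n (ℕ.s≤s (ℕ.s≤s (ℕ.s≤s (ℕ.s≤s (ℕ.s≤s (ℕ.z≤n {e})))))) 2≤n =
  Realisation.Construction.theorem R e n 2≤n
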